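{- (i) An integer $n>1$ with at most two distinct prime divisors is a primitive covering number if and only if $n=2^{p-1}p$ for some odd prime $p$. (ii) A positive integer $n\equiv 0\pmod 3$ with exactly three distinct prime divisors is a primitive covering number if and only if $n=2\cdot 3^{(p-1)/2}p$ for some prime $p>3$. (iii) If $p>5$ is a prime, then both $2^3 5^{\lfloor (p-1)/4\rfloor}p$ and $2\cdot 3\cdot 5^{\lfloor (p-1)/4\rfloor}p$ are primitive covering numbers. If $p>7$ is a prime, then $2\cdot 3^2\, 7^{\lfloor (p-1)/6\rfloor}p$ is a primitive covering number, and so is $2^5 7^{\lfloor (p-1)/6\rfloor}p$ provided that $p\neq 13,19$.
   Context: For $a\in\mathbb{Z}$ and a positive integer $n$, $a(\mathrm{mod}\ n)=\{a+nx: x\in\mathbb{Z}\}$ is the residue class with modulus $n$. A finite system of residue classes $\{a_i(\mathrm{mod}\ n_i)\}_{i=1}^k$ is a cover of $\mathbb{Z}$ if every integer lies in at least one of the classes $a_i(\mathrm{mod}\ n_i)$. A positive integer $n$ is called a covering number if there is a cover of $\mathbb{Z}$ whose moduli are all distinct, greater than one, and divisors of $n$. A covering number is called a primitive covering number if none of its proper divisors (positive divisors smaller than the number itself) is a covering number. $\lfloor x\rfloor$ denotes the greatest integer not exceeding $x$. -}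

module Defs where

open import Data.Fin.Base using (Fin)
open import Data.Integer.Base as ℤ using (ℤ; +_)
open import Data.List.Base using (List; filter; length; upTo)
open import Data.Nat.Base using (ℕ; suc; _<_; NonZero)
open import Data.Nat.Divisibility using (_∣_; _∣?_)
open import Data.Nat.Primality using (prime?)
open import Data.Product.Base using (_×_; ∃-syntax)
open import Function.Definitions using (Injective)
open import Relation.Binary.PropositionalEquality.Core using (_≡_)
open import Relation.Nullary.Decidable using (_×-dec_)
open import Relation.Nullary.Negation.Core using (¬_)

record ResidueClass : Set where
  constructor _mod_
  field
    residue     : ℤ
    modulus     : ℕ
    {{nonZero}} : NonZero modulus

open ResidueClass public using (residue; modulus)

infix 4 _∈ᶜ_

_∈ᶜ_ : ℤ → ResidueClass → Set
z ∈ᶜ A = ∃[ x ] z ≡ residue A ℤ.+ + modulus A ℤ.* x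

System : ℕ → Set
System k = Fin k → ResidueClass

IsCover : ∀ {k} → System k → Set
IsCover A = ∀ z → ∃[ i ] z ∈ᶜ A i

CoveringNumber : ℕ → Set
CoveringNumber n =
  0 < n ×
  (∃[ k ] ∃[ A ] IsCover {k} A
    × Injective _≡_ _≡_ (λ i → modulus (A i))
    × (∀ i → 1 < modulus (A i))
    × (∀ i → modulus (A i) ∣ n))

PrimitiveCoveringNumber : ℕ → Set
PrimitiveCoveringNumber n =
  CoveringNumber n × (∀ d → d ∣ n → d < n → ¬ CoveringNumber d)

-- Meaningful for n > 0 only, where every divisor of n occurs in upTo (suc n).
primeDivisors : ℕ → List ℕ
primeDivisors n = filter (λ p → prime? p ×-dec (p ∣? n)) (upTo (suc n))

ω : ℕ → ℕ
ω n = length (primeDivisors n)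

{-# OPTIONS --safe #-}
module Submission where

-- Two tools decide which n are covering numbers. Write τ for the number of divisors, p for a prime not dividing m.
-- Reduction: if τ(m) < p and m p^(a+1) is a covering number, then so is m p^a. A point missed by the moduli dividing
-- m p^a has p translates by multiples of m p^a, all missed by these moduli too, and each of the τ(m) other moduli
-- catches at most one of the translates.
-- Construction: if p - 1 ≤ τ(m) and the divisors of m can cover everything but 0 (mod m), then the divisors of m p^a
-- can cover everything but 0 (mod m p^a); if even p ≤ τ(m), then m p is a covering number.
-- These settle every case except that of odd n with two or three prime divisors, which are not covering numbers by a
-- density argument applied separately to the moduli prime to one of the primes.

open import Defs
open import Data.Empty using (⊥; ⊥-elim)
open import Data.Fin.Base as Fin using (Fin; toℕ)
import Data.Fin.Properties as Fin
open import Data.Integer.Base as ℤ using (ℤ; +_)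
import Data.Integer.DivMod as ℤ
import Data.Integer.Divisibility.Signed as ℤ
import Data.Integer.Properties as ℤ
open import Data.Integer.Tactic.RingSolver using () renaming (solve-∀ to solveℤ)
open import Data.List.Base using (List; []; _∷_; _++_; length; lookup; map; filter; upTo; applyUpTo)
open import Data.List.Membership.Propositional using (_∈_; find; lose)
open import Data.List.Membership.Propositional.Properties
  using (∈-++⁺ˡ; ∈-++⁺ʳ; ∈-++⁻; ∈-map⁺; ∈-map⁻; ∈-filter⁺; ∈-filter⁻; ∈-upTo⁺; ∈-lookup)
open import Data.List.Properties using (length-++; length-map; length-upTo; map-++; map-∘; map-upTo)
import Data.List.Relation.Binary.Permutation.Propositional as ↭
open ↭ using (_↭_; ↭⇒↭ₛ)
open import Data.List.Relation.Binary.Permutation.Propositional.Properties using (All-resp-↭; ∈-resp-↭)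
open import Data.List.Relation.Unary.All as All using (All; []; _∷_)
open import Data.List.Relation.Unary.All.Properties using () renaming (all-filter to All-filter)
open import Data.List.Relation.Unary.AllPairs using ([]; _∷_)
open import Data.List.Relation.Unary.Any as Any using (here; there)
import Data.List.Relation.Unary.Any.Properties as Any
open import Data.List.Relation.Unary.Unique.Propositional using (Unique)
import Data.List.Relation.Unary.Unique.Propositional.Properties as Unique
open import Data.Nat.Base
open import Data.Nat.Coprimality as Coprime using (Coprime; coprime-divisor)
open import Data.Nat.Divisibility
open import Data.Nat.DivMod using (m*n/n≡m; m%n<n; m≡m%n+[m/n]*n; m/n*n≤m; m<n*o⇒m/o<n)
open import Data.Nat.GCD using (gcd; gcd[m,n]∣m; gcd[m,n]∣n)
open import Data.Nat.Induction using (<-rec)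
open import Data.Nat.ListAction using (sum; product)
open import Data.Nat.ListAction.Properties using (sum-++)
open import Data.Nat.Primality
open import Data.Nat.Primality.Factorisation using (factorise)
open import Data.Nat.Properties
open import Data.Nat.Tactic.RingSolver using (solve-∀)
open import Data.Product.Base using (_×_; _,_; proj₁; proj₂; ∃; ∃-syntax; ∃₂)
open import Data.Sum.Base using (_⊎_; inj₁; inj₂; [_,_]′)
open import Function.Base using (_∘_; id)
open import Function.Bundles using (_⇔_; mk⇔)
open import Function.Definitions using (Injective)
open import Relation.Binary.PropositionalEquality
open import Data.List.Relation.Binary.Permutation.Setoid.Properties (setoid ℕ) using (Unique-resp-↭)
open import Relation.Nullary using (¬_; Dec; yes; no; contradiction)
open import Relation.Nullary.Decidable using (True; _×-dec_; toWitness; from-yes; from-no; _→-dec_; _⊎-dec_; ¬?)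

-- The exponents come from divisor counts. Every family has the form m q^b p with τ(m) = q - 1: m =
-- 1 for q = 2, m = 2 for q = 3, m = 2^3 or 6 for q = 5, m = 18 or 2^5 for q = 7. This is the one
-- value of τ(m) at which both tools apply to q: m q^b is never a covering number, yet its divisors
-- cover everything but one class. As τ(m q^b) = (q - 1)(b + 1), the least b with τ(m q^b) ≥ p is
-- the floor of (p - 1)/(q - 1). Primitivity also asks that proper divisors of m leave too few
-- moduli. For m = 2^5 this is settled by 5(b + 1) < p, which fails at 13 and 19. For odd n divisor
-- counts do not suffice, as τ(3^a) is unbounded, and neither does the plain density bound σ(n)/n <
-- 2: with the primes 3, 5, 7 the quotient approaches 3/2 · 5/4 · 7/6 = 35/16. Splitting n = P M
-- into coprime factors asks only for σ(P)/P + σ(M)/M < 3, and 3/2 + 35/24 < 3.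

infix 4 _∣ℤ_

_∣ℤ_ : ℤ → ℤ → Set
_∣ℤ_ = ℤ._∣_

-- A cover with distinct moduli is a choice c of one residue for every candidate modulus.
CoveredBy : (ℕ → ℤ) → ℕ → ℤ → Set
CoveredBy c n z = ∃[ d ] 1 < d × d ∣ n × + d ∣ℤ z ℤ.- c d

Covers : (ℕ → ℤ) → ℕ → Set
Covers c n = ∀ z → CoveredBy c n z

Coverable : ℕ → Set
Coverable n = ∃[ c ] Covers c n

coverable-∣ : ∀ {m n} → m ∣ n → Coverable m → Coverable n
coverable-∣ m∣n (c , cov) = c , λ z → let d , 1<d , d∣m , h = cov z in d , 1<d , ∣-trans d∣m m∣n , h

¬coverable-1 : ¬ Coverable 1
¬coverable-1 (c , cov) with d , 1<d , d∣1 , _ ← cov (+ 0) = <⇒≢ 1<d (sym (∣1⇒≡1 d∣1))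

covering⇒coverable : ∀ {n} → CoveringNumber n → Coverable n
covering⇒coverable {n} (_ , k , A , cover , inj , >1 , ∣n) = c , covers
  where
  c : ℕ → ℤ
  c d with Fin.any? (λ i → modulus (A i) ≟ d)
  ... | yes (i , _) = residue (A i)
  -- Moduli absent from the system get an arbitrary residue, since an extra class cannot spoil a
  -- cover.
  ... | no _        = + 0

  c-modulus : ∀ i → c (modulus (A i)) ≡ residue (A i)
  c-modulus i with Fin.any? (λ j → modulus (A j) ≟ modulus (A i))
  ... | yes (j , eq) = cong (residue ∘ A) (inj eq)
  ... | no ¬any      = contradiction (i , refl) ¬any

  covers : Covers c n
  covers z with i , x , z≡ ← cover z = d , >1 i , ∣n i , ℤ.divides x (begin
      z ℤ.- c d                       ≡⟨ cong₂ ℤ._-_ z≡ (c-modulus i) ⟩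
      residue (A i) ℤ.+ + d ℤ.* x ℤ.- residue (A i)
                                      ≡⟨ lemma (residue (A i)) (+ d) x ⟩
      x ℤ.* + d ∎)
    where
    open ≡-Reasoning
    d = modulus (A i)
    lemma : ∀ r d x → r ℤ.+ d ℤ.* x ℤ.- r ≡ x ℤ.* d
    lemma = solveℤ

lookup-injective : ∀ {A : Set} {xs : List A} → Unique xs → Injective _≡_ _≡_ (lookup xs)
lookup-injective (_ ∷ _) {Fin.zero} {Fin.zero} _ = refl
lookup-injective (x∉ ∷ _) {Fin.zero} {Fin.suc j} eq = contradiction eq (All.lookup x∉ (∈-lookup j))
lookup-injective (x∉ ∷ _) {Fin.suc i} {Fin.zero} eq = contradiction (sym eq) (All.lookup x∉ (∈-lookup i))
lookup-injective (_ ∷ u) {Fin.suc i} {Fin.suc j} eq = cong Fin.suc (lookup-injective u eq)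

-- The system takes one class for every divisor of `n` above 1, so that distinctness of the moduli
-- becomes uniqueness of the list `ds`.
coverable⇒covering : ∀ {n} → 0 < n → Coverable n → CoveringNumber n
coverable⇒covering {n} 0<n (c , cov) =
  0<n , length ds , A , cover , lookup-injective (Unique.filter⁺ P? (Unique.upTo⁺ (suc n)))
  , (λ i → proj₁ (good i)) , (λ i → proj₂ (good i))
  where
  P? : ∀ d → Dec (1 < d × d ∣ n)
  P? d = 1 <? d ×-dec (d ∣? n)
  ds = filter P? (upTo (suc n))

  good : ∀ i → 1 < lookup ds i × lookup ds i ∣ n
  good i = proj₂ (∈-filter⁻ P? {xs = upTo (suc n)} (∈-lookup i))

  A : System (length ds)
  A i = _mod_ (c (lookup ds i)) (lookup ds i) {{>-nonZero (<-trans z<s (proj₁ (good i)))}}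

  cover : IsCover A
  cover z with d , 1<d , d∣n , ℤ.divides q eq ← cov z = Any.index d∈ , q , (begin
      z                                         ≡⟨ lemma z (c d) ⟩
      c d ℤ.+ (z ℤ.- c d)                       ≡⟨ cong (λ w → c d ℤ.+ w) eq ⟩
      c d ℤ.+ q ℤ.* + d                         ≡⟨ cong (λ w → c d ℤ.+ w) (ℤ.*-comm q (+ d)) ⟩
      c d ℤ.+ + d ℤ.* q                         ≡⟨ cong (λ d → c d ℤ.+ + d ℤ.* q) (Any.lookup-index d∈) ⟩
      c (lookup ds (Any.index d∈)) ℤ.+ + lookup ds (Any.index d∈) ℤ.* q ∎)
    where
    open ≡-Reasoning
    d∈ : d ∈ ds
    d∈ = ∈-filter⁺ P? (∈-upTo⁺ (s≤s (∣⇒≤ {{>-nonZero 0<n}} d∣n))) (1<d , d∣n)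
    lemma : ∀ z r → z ≡ r ℤ.+ (z ℤ.- r)
    lemma = solveℤ

prime∤⇒coprime : ∀ {p d} → Prime p → ¬ p ∣ d → Coprime d p
prime∤⇒coprime pr p∤d (i∣d , i∣p) with prime⇒irreducible pr i∣p
... | inj₁ i≡1 = i≡1
... | inj₂ refl = contradiction i∣d p∤d

-- If `p ∤ d`, a factor `p` cancels by coprimality. Otherwise `d / p` divides `m p^a`, and induction
-- on `a` tells whether it already carries the full power of `p`. The second alternative describes
-- the new moduli in both tools.
∣m*p^⇒ : ∀ {p m d} → Prime p → ¬ p ∣ m → ∀ a → d ∣ m * p ^ suc a →
  d ∣ m * p ^ a ⊎ ∃[ e ] e ∣ m × d ≡ e * p ^ suc a
∣m*p^⇒ {p} {m} {d} pr p∤m a d∣ with p ∣? d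
... | no p∤d = inj₁ (coprime-divisor (prime∤⇒coprime pr p∤d)
                (subst (d ∣_) (lemma m p (p ^ a)) d∣))
  where
  lemma : ∀ m p x → m * (p * x) ≡ p * (m * x)
  lemma = solve-∀
... | yes (divides d' refl) = extend a (*-cancelʳ-∣ p {{prime⇒nonZero pr}} (subst (d ∣_) (lemma m p (p ^ a)) d∣))
  where
  lemma : ∀ m p x → m * (p * x) ≡ m * x * p
  lemma = solve-∀
  extend : ∀ a → d' ∣ m * p ^ a → d' * p ∣ m * p ^ a ⊎ ∃[ e ] e ∣ m × d' * p ≡ e * p ^ suc a
  extend zero d'∣ = inj₂ (d' , subst (d' ∣_) (*-identityʳ m) d'∣ , cong (d' *_) (sym (*-identityʳ p)))
  extend (suc a) d'∣ with ∣m*p^⇒ pr p∤m a d'∣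
  ... | inj₁ h = inj₁ (subst (d' * p ∣_) (sym (lemma m p (p ^ a))) (*-monoˡ-∣ p h))
  ... | inj₂ (e , e∣m , refl) = inj₂ (e , e∣m , sym (lemma e p (p * p ^ a)))

-- Divisors of m p^a

record IsDivisorList (m : ℕ) (L : List ℕ) : Set where
  field
    unique   : Unique L
    sound    : ∀ {d} → d ∈ L → d ∣ m
    complete : ∀ {d} → d ∣ m → d ∈ L

open IsDivisorList

-- Each step appends the block of new divisors, which gives lengths and divisor sums a recursion in
-- `a` and keeps the head of the list in place.
divisorsTimes : List ℕ → ℕ → ℕ → List ℕ
divisorsTimes L p zero    = L
divisorsTimes L p (suc a) = divisorsTimes L p a ++ map (_* p ^ suc a) L

divisorList-1 : IsDivisorList 1 (1 ∷ [])
divisorList-1 = record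
  { unique   = [] ∷ []
  ; sound    = λ { (here refl) → ∣-refl }
  ; complete = λ d∣1 → here (∣1⇒≡1 d∣1)
  }

divisorList-*^ : ∀ {m L p} → Prime p → ¬ p ∣ m → 0 < m → IsDivisorList m L → ∀ a →
  IsDivisorList (m * p ^ a) (divisorsTimes L p a)
divisorList-*^ {m} {L} pr p∤m 0<m I zero =
  subst (λ n → IsDivisorList n L) (sym (*-identityʳ m)) I
divisorList-*^ {m} {L} {p} pr p∤m 0<m I (suc a) = record
  { unique = Unique.++⁺ (unique IH) (Unique.map⁺ (*-cancelʳ-≡ _ _ q {{q≢0}}) (unique I)) disjoint
  ; sound = λ d∈ → [ sound-old , sound-new ]′ (∈-++⁻ (divisorsTimes L p a) d∈)
  ; complete = λ d∣ → [ (λ h → ∈-++⁺ˡ (complete IH h))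
                      , (λ { (e , e∣m , refl) → ∈-++⁺ʳ (divisorsTimes L p a) (∈-map⁺ (_* q) (complete I e∣m)) }) ]′
                      (∣m*p^⇒ pr p∤m a d∣)
  }
  where
  IH = divisorList-*^ pr p∤m 0<m I a
  q = p ^ suc a
  instance
    p≢0 : NonZero p
    p≢0 = prime⇒nonZero pr
    m≢0 : NonZero m
    m≢0 = >-nonZero 0<m
    q≢0 : NonZero q
    q≢0 = m^n≢0 p (suc a)
    p^a≢0 : NonZero (p ^ a)
    p^a≢0 = m^n≢0 p a

  sound-old : ∀ {d} → d ∈ divisorsTimes L p a → d ∣ m * q
  sound-old d∈ = ∣-trans (sound IH d∈) (*-monoʳ-∣ m (n∣m*n p))

  sound-new : ∀ {d} → d ∈ map (_* q) L → d ∣ m * q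
  sound-new d∈ with e , e∈ , refl ← ∈-map⁻ (_* q) d∈ = *-monoˡ-∣ q (sound I e∈)

  disjoint : ∀ {d} → ¬ (d ∈ divisorsTimes L p a × d ∈ map (_* q) L)
  disjoint (d∈ , d∈') with e , e∈ , refl ← ∈-map⁻ (_* q) d∈' =
    p∤m (*-cancelʳ-∣ (p ^ a) (∣-trans (n∣m*n e) (sound IH d∈)))

length-divisorsTimes : ∀ L p a → length (divisorsTimes L p a) ≡ length L * suc a
length-divisorsTimes L p zero = sym (*-identityʳ (length L))
length-divisorsTimes L p (suc a) = begin
  length (divisorsTimes L p a ++ map (_* p ^ suc a) L) ≡⟨ length-++ (divisorsTimes L p a) ⟩
  length (divisorsTimes L p a) + length (map (_* p ^ suc a) L)
    ≡⟨ cong₂ _+_ (length-divisorsTimes L p a) (length-map _ L) ⟩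
  length L * suc a + length L  ≡⟨ lemma (length L) a ⟩
  length L * suc (suc a) ∎
  where
  open ≡-Reasoning
  lemma : ∀ l a → l * suc a + l ≡ l * suc (suc a)
  lemma = solve-∀

-- The relation τ(m) = t for positive `m`; as a relation it lets `t` be read off from a
-- factorisation of `m`.
record DivisorCount (m t : ℕ) : Set where
  field
    {divisors}     : List ℕ
    isDivisorList  : IsDivisorList m divisors
    length≡        : length divisors ≡ t
    positive       : 0 < m

open DivisorCount

divisorCount-1 : DivisorCount 1 1
divisorCount-1 = record { isDivisorList = divisorList-1 ; length≡ = refl ; positive = z<s }

divisorCount-*^ : ∀ {p m t} → Prime p → ¬ p ∣ m → DivisorCount m t → ∀ a → DivisorCount (m * p ^ a) (t * suc a)
divisorCount-*^ {p} {m} pr p∤m D a = record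
  { isDivisorList = divisorList-*^ pr p∤m (positive D) (isDivisorList D) a
  ; length≡       = trans (length-divisorsTimes (divisors D) p a) (cong (_* suc a) (length≡ D))
  ; positive      = >-nonZero⁻¹ (m * p ^ a)
                      {{m*n≢0 m (p ^ a) {{>-nonZero (positive D)}} {{m^n≢0 p a {{prime⇒nonZero pr}}}}}}
  }

-- Reduction

-- A finite search replaces the classical step from "no translate lies in an old class" to "every
-- translate lies in a new class".
∀⊎⇒∃⊎∀ : ∀ {n} {A B : Fin n → Set} → (∀ i → A i ⊎ B i) → ∃ A ⊎ (∀ i → B i)
∀⊎⇒∃⊎∀ {zero} f = inj₂ λ ()
∀⊎⇒∃⊎∀ {suc n} f with f Fin.zero | ∀⊎⇒∃⊎∀ (f ∘ Fin.suc)
... | inj₁ a | _             = inj₁ (Fin.zero , a)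
... | inj₂ _ | inj₁ (i , a)  = inj₁ (Fin.suc i , a)
... | inj₂ b | inj₂ bs       = inj₂ λ { Fin.zero → b ; (Fin.suc i) → bs i }

∣-difference : ∀ {d w r} z → + d ∣ℤ z ℤ.+ w ℤ.- r → + d ∣ℤ z ℤ.- r → + d ∣ℤ w
∣-difference {d} {w} {r} z h h' = subst (+ d ∣ℤ_) (lemma z w r) (ℤ.∣m∣n⇒∣m-n h h')
  where
  lemma : ∀ z w r → z ℤ.+ w ℤ.- r ℤ.- (z ℤ.- r) ≡ w
  lemma = solveℤ

-- A residue class modulo e p^(a+1) contains at most one of the p translates of z by multiples of m p^a,
-- while a class modulo a divisor of m p^a contains all or none of them.
covers-reduce : ∀ {c p m L} → Prime p → ¬ p ∣ m → 0 < m → IsDivisorList m L → length L < p → ∀ a →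
  Covers c (m * p ^ suc a) → Covers c (m * p ^ a)
covers-reduce {c} {p} {m} {L} pr p∤m 0<m I τ<p a cov z = [ done , (λ new → ⊥-elim (absurd new)) ]′ (∀⊎⇒∃⊎∀ step)
  where
  N q : ℕ
  N = m * p ^ a
  q = p ^ suc a
  pt : ℕ → ℤ
  pt j = z ℤ.+ + (j * N)

  Old New : Fin p → Set
  Old j = ∃[ d ] 1 < d × d ∣ N × + d ∣ℤ pt (toℕ j) ℤ.- c d
  New j = ∃[ e ] e ∈ L × + (e * q) ∣ℤ pt (toℕ j) ℤ.- c (e * q)

  step : ∀ j → Old j ⊎ New j
  step j with d , 1<d , d∣ , h ← cov (pt (toℕ j)) with ∣m*p^⇒ pr p∤m a d∣
  ... | inj₁ d∣N = inj₁ (d , 1<d , d∣N , h)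
  ... | inj₂ (e , e∣m , refl) = inj₂ (e , complete I e∣m , h)

  done : ∃ Old → CoveredBy c N z
  done (j , d , 1<d , d∣N , h) = d , 1<d , d∣N ,
    ℤ.∣m+n∣n⇒∣m (subst (+ d ∣ℤ_) (lemma z (+ (toℕ j * N)) (c d)) h) (ℤ.∣ᵤ⇒∣ (∣n⇒∣m*n (toℕ j) d∣N))
    where
    lemma : ∀ z w r → z ℤ.+ w ℤ.- r ≡ z ℤ.- r ℤ.+ w
    lemma = solveℤ

  -- Two translates in one class modulo `e q` differ by `k N`, so `q ∣ k N`; cancelling `p^a` leaves
  -- `p ∣ k m`.
  separated : ∀ {e} i k → + (e * q) ∣ℤ pt i ℤ.- c (e * q) → + (e * q) ∣ℤ pt (k + i) ℤ.- c (e * q) → p ∣ k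
  separated {e} i k h h' = [ id , (λ p∣m → contradiction p∣m p∤m) ]′ (euclidsLemma k m pr p∣km)
    where
    instance
      p^a≢0 : NonZero (p ^ a)
      p^a≢0 = m^n≢0 p a {{prime⇒nonZero pr}}
    pt-+ : pt (k + i) ≡ pt i ℤ.+ + (k * N)
    pt-+ = begin
      z ℤ.+ + ((k + i) * N)             ≡⟨ cong (λ x → z ℤ.+ + x) (trans (*-distribʳ-+ N k i) (+-comm (k * N) (i * N))) ⟩
      z ℤ.+ (+ (i * N) ℤ.+ + (k * N))   ≡⟨ ℤ.+-assoc z (+ (i * N)) (+ (k * N)) ⟨
      pt i ℤ.+ + (k * N) ∎
      where open ≡-Reasoning
    q∣kN : q ∣ k * N
    q∣kN = ∣-trans (n∣m*n e)
      (ℤ.∣⇒∣ᵤ (∣-difference (pt i) (subst (λ x → + (e * q) ∣ℤ x ℤ.- c (e * q)) pt-+ h') h))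
    p∣km : p ∣ k * m
    p∣km = *-cancelʳ-∣ (p ^ a) (subst (q ∣_) (sym (*-assoc k m (p ^ a))) q∣kN)

  absurd : (∀ j → New j) → ⊥
  -- Fewer than `p` new moduli serve `p` translates, so two translates share one; their distance
  -- `j - i` would be a positive multiple of `p` below `p`.
  absurd new with i , j , i<j , eq ← Fin.pigeonhole τ<p (λ j → Any.index (proj₁ (proj₂ (new j))))
    with new i | new j
  ... | e , e∈ , h | e' , e'∈ , h'
    with refl ← trans (Any.lookup-index e∈) (trans (cong (lookup L) eq) (sym (Any.lookup-index e'∈)))
    = <⇒≱ k<p (∣⇒≤ {{>-nonZero (m<n⇒0<n∸m i<j)}} (separated {e} (toℕ i) (toℕ j ∸ toℕ i) h
        (subst (λ x → + (e * q) ∣ℤ pt x ℤ.- c (e * q)) (sym (m∸n+n≡m (<⇒≤ i<j))) h')))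
    where
    k<p : toℕ j ∸ toℕ i < p
    k<p = ≤-<-trans (m∸n≤m (toℕ j) (toℕ i)) (Fin.toℕ<n j)

coverable-reduce : ∀ {p m t} → Prime p → ¬ p ∣ m → DivisorCount m t → t < p → ∀ a →
  Coverable (m * p ^ suc a) → Coverable (m * p ^ a)
coverable-reduce {p} pr p∤m D t<p a (c , cov) =
  c , covers-reduce pr p∤m (positive D) (isDivisorList D) (subst (_< p) (sym (length≡ D)) t<p) a cov

¬coverable-*^ : ∀ {p m t} → Prime p → ¬ p ∣ m → DivisorCount m t → t < p →
  ¬ Coverable m → ∀ a → ¬ Coverable (m * p ^ a)
¬coverable-*^ {m = m} pr p∤m D t<p ¬m zero (c , cov) = ¬m (c , subst (Covers c) (*-identityʳ m) cov)
¬coverable-*^ {p} pr p∤m D t<p ¬m (suc a) cov = ¬coverable-*^ pr p∤m D t<p ¬m a (coverable-reduce pr p∤m D t<p a cov)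

-- Construction of covers

-- The exceptional class is normalised to 0, so that refining it modulo a further prime leaves an
-- exception of the same kind.
NearCovers : (ℕ → ℤ) → ℕ → Set
NearCovers c n = ∀ z → + n ∣ℤ z ⊎ CoveredBy c n z

NearCoverable : ℕ → Set
NearCoverable n = ∃[ c ] NearCovers c n

nearCoverable-1 : NearCoverable 1
nearCoverable-1 = (λ _ → + 0) , λ z → inj₁ (ℤ.∣ᵤ⇒∣ (1∣ _))

-- A residue choice is a function of the modulus, so the position of a divisor in the list has to be
-- recovered from its value.
indexOf : List ℕ → ℕ → ℕ
indexOf []       y = 0
indexOf (x ∷ xs) y with x ≟ y
... | yes _ = 0
... | no _  = suc (indexOf xs y)

indexOf-lookup : ∀ {xs} → Unique xs → ∀ i → indexOf xs (lookup xs i) ≡ toℕ i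
indexOf-lookup {x ∷ xs} u Fin.zero with x ≟ x
... | yes _ = refl
... | no x≢x = contradiction refl x≢x
indexOf-lookup {x ∷ xs} (x∉ ∷ u) (Fin.suc i) with x ≟ lookup xs i
... | yes eq = contradiction eq (All.lookup x∉ (∈-lookup i))
... | no _ = cong suc (indexOf-lookup u i)

-- The class 0 mod M splits into p classes modulo M p, where M = m p^a; the new moduli e p^(a+1), e ∣ m, swallow
-- one of these classes each, beginning with the class of M s.
refine-cover : ∀ {c p m L} → Prime p → ¬ p ∣ m → 0 < m → IsDivisorList m L → ∀ a s → NearCovers c (m * p ^ a) →
  ∃[ c' ] ∀ z → CoveredBy c' (m * p ^ suc a) z ⊎
    (∃[ r ] r < p × ¬ (s ≤ r × r < s + length L) × + (m * p ^ suc a) ∣ℤ z ℤ.- + (m * p ^ a * r))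
refine-cover {c} {p} {m} {L} pr p∤m 0<m I a s near = c' , covered
  where
  M q : ℕ
  M = m * p ^ a
  q = p ^ suc a
  instance
    p≢0 : NonZero p
    p≢0 = prime⇒nonZero pr
    q≢0 : NonZero q
    q≢0 = m^n≢0 p (suc a)
    p^a≢0 : NonZero (p ^ a)
    p^a≢0 = m^n≢0 p a

  c' : ℕ → ℤ
  c' d with d ∣? M
  ... | yes _ = c d
  -- A divisor of `m q` that does not divide `M` is `e q` with `e ∣ m`; `d / q` recovers `e`, whose
  -- position `i` in `L` assigns it the class of `M (s + i)`.
  ... | no _  = + (M * (s + indexOf L (d / q)))

  c'-old : ∀ {d} → d ∣ M → c d ≡ c' d
  c'-old {d} d∣M with d ∣? M
  ... | yes _   = refl
  ... | no d∤M = contradiction d∣M d∤M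

  c'-new : ∀ i → + (M * (s + toℕ i)) ≡ c' (lookup L i * q)
  c'-new i with (lookup L i * q) ∣? M
  ... | yes d∣M = contradiction (*-cancelʳ-∣ (p ^ a) (∣-trans (n∣m*n (lookup L i)) d∣M)) p∤m
  ... | no _    = cong (λ j → + (M * (s + j)))
                    (sym (trans (cong (indexOf L) (m*n/n≡m (lookup L i) q)) (indexOf-lookup (unique I) i)))

  residue-class : ∀ z → + M ∣ℤ z → ∃[ r ] r < p × + (m * q) ∣ℤ z ℤ.- + (M * r)
  residue-class z (ℤ.divides y z≡) = y ℤ.%ℕ p , ℤ.n%ℕd<d y p , ℤ.divides (y ℤ./ℕ p) (begin
    z ℤ.- + (M * r)                              ≡⟨ cong₂ ℤ._-_ z≡ (ℤ.pos-* M r) ⟩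
    y ℤ.* + M ℤ.- + M ℤ.* + r                    ≡⟨ cong (λ y → y ℤ.* + M ℤ.- + M ℤ.* + r) (ℤ.a≡a%ℕn+[a/ℕn]*n y p) ⟩
    (+ r ℤ.+ t ℤ.* + p) ℤ.* + M ℤ.- + M ℤ.* + r  ≡⟨ lemma (+ r) t (+ p) (+ M) ⟩
    t ℤ.* (+ M ℤ.* + p)                          ≡⟨ cong (t ℤ.*_) (ℤ.pos-* M p) ⟨
    t ℤ.* + (M * p)                              ≡⟨ cong (λ x → t ℤ.* + x) (assoc m p (p ^ a)) ⟩
    t ℤ.* + (m * q) ∎)
    where
    open ≡-Reasoning
    r = y ℤ.%ℕ p
    t = y ℤ./ℕ p
    lemma : ∀ r t p M → (r ℤ.+ t ℤ.* p) ℤ.* M ℤ.- M ℤ.* r ≡ t ℤ.* (M ℤ.* p)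
    lemma = solveℤ
    assoc : ∀ m p x → m * x * p ≡ m * (p * x)
    assoc = solve-∀

  1<e*q : ∀ {e} → e ∈ L → 1 < e * q
  1<e*q {e} e∈ = <-≤-trans (nonTrivial⇒n>1 p {{prime⇒nonTrivial pr}})
    (∣⇒≤ {{m*n≢0 e q {{≢-nonZero λ { refl → <⇒≢ 0<m (sym (0∣⇒≡0 (sound I e∈))) }}}}} (∣n⇒∣m*n e (m∣m*n (p ^ a))))

  covered : ∀ z → CoveredBy c' (m * q) z ⊎
    (∃[ r ] r < p × ¬ (s ≤ r × r < s + length L) × + (m * q) ∣ℤ z ℤ.- + (M * r))
  covered z with near z
  ... | inj₂ (d , 1<d , d∣M , h) =
    inj₁ (d , 1<d , ∣-trans d∣M (*-monoʳ-∣ m (n∣m*n p)) , subst (λ r → + d ∣ℤ z ℤ.- r) (c'-old d∣M) h)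
  ... | inj₁ M∣z with r , r<p , h ← residue-class z M∣z with s ≤? r | r <? s + length L
  ... | no s≰r  | _       = inj₂ (r , r<p , (λ (s≤r , _) → s≰r s≤r) , h)
  ... | yes _   | no r≮   = inj₂ (r , r<p , (λ (_ , r<) → r≮ r<) , h)
  ... | yes s≤r | yes r<  = inj₁ (e * q , 1<e*q e∈ , e*q∣ ,
          subst (λ w → + (e * q) ∣ℤ z ℤ.- w) c'≡ (ℤ.∣-trans (ℤ.∣ᵤ⇒∣ e*q∣) h))
    where
    i<τ : r ∸ s < length L
    i<τ = subst (r ∸ s <_) (m+n∸m≡n s (length L)) (∸-monoˡ-< r< s≤r)
    i = Fin.fromℕ< i<τ
    e = lookup L i
    e∈ : e ∈ L
    e∈ = ∈-lookup i
    e*q∣ : e * q ∣ m * q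
    e*q∣ = *-monoˡ-∣ q (sound I e∈)
    c'≡ : + (M * r) ≡ c' (e * q)
    c'≡ = trans (cong (λ x → + (M * x)) (sym (trans (cong (λ j → s + j) (Fin.toℕ-fromℕ< i<τ)) (m+[n∸m]≡n s≤r))))
      (c'-new i)

nearCoverable-*^ : ∀ {p m t} → Prime p → ¬ p ∣ m → DivisorCount m t → p ≤ 1 + t →
  NearCoverable m → ∀ a → NearCoverable (m * p ^ a)
nearCoverable-*^ {m = m} pr p∤m D p≤ N zero = subst NearCoverable (sym (*-identityʳ m)) N
nearCoverable-*^ {p} {m} pr p∤m D p≤ N (suc a)
  with c , near ← nearCoverable-*^ pr p∤m D p≤ N a
  -- Starting at `s = 1` spares the class of 0; the other `p - 1` classes are swallowed because
  -- `p - 1 ≤ t`.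
  with c' , split ← refine-cover pr p∤m (positive D) (isDivisorList D) a 1 near = c' , near'
  where
  near' : NearCovers c' (m * p ^ suc a)
  near' z with split z
  ... | inj₁ h = inj₂ h
  ... | inj₂ (zero , _ , _ , h) = inj₁ (subst (+ (m * p ^ suc a) ∣ℤ_)
    (trans (cong (λ x → z ℤ.- + x) (*-zeroʳ (m * p ^ a))) (ℤ.+-identityʳ z)) h)
  ... | inj₂ (suc r , r<p , r∉ , _) =
    contradiction (s≤s z≤n , <-≤-trans r<p (subst (λ t → p ≤ 1 + t) (sym (length≡ D)) p≤)) r∉

coverable-* : ∀ {p m t} → Prime p → ¬ p ∣ m → DivisorCount m t → p ≤ t →
  NearCoverable m → Coverable (m * p)
coverable-* {p} {m} pr p∤m D p≤ (c , near)
  -- Starting at `s = 0`, the moduli `e p` swallow all `p` classes, that of 0 included.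
  with c' , split ← refine-cover {c} pr p∤m (positive D) (isDivisorList D) 0 0
    (subst (NearCovers c) (sym (*-identityʳ m)) near) =
  subst Coverable (cong (m *_) (*-identityʳ p))
    (c' , λ z → [ id , (λ (r , r<p , r∉ , _) →
      contradiction (z≤n , <-≤-trans r<p (subst (p ≤_) (sym (length≡ D)) p≤)) r∉) ]′ (split z))

-- Counting

∑ : {A : Set} → List A → (A → ℕ) → ℕ
∑ xs f = sum (map f xs)

∑-mono : ∀ {A : Set} xs {f g : A → ℕ} → (∀ {x} → x ∈ xs → f x ≤ g x) → ∑ xs f ≤ ∑ xs g
∑-mono []       f≤g = z≤n
∑-mono (x ∷ xs) f≤g = +-mono-≤ (f≤g (here refl)) (∑-mono xs (f≤g ∘ there))

∑-cong : ∀ {A : Set} xs {f g : A → ℕ} → (∀ {x} → x ∈ xs → f x ≡ g x) → ∑ xs f ≡ ∑ xs g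
∑-cong []       f≡g = refl
∑-cong (x ∷ xs) f≡g = cong₂ _+_ (f≡g (here refl)) (∑-cong xs (f≡g ∘ there))

∑-+ : ∀ {A : Set} xs {f g : A → ℕ} → ∑ xs (λ x → f x + g x) ≡ ∑ xs f + ∑ xs g
∑-+ []               = refl
∑-+ (x ∷ xs) {f} {g} = trans (cong (λ k → f x + g x + k) (∑-+ xs)) (lemma (f x) (g x) (∑ xs f) (∑ xs g))
  where
  lemma : ∀ a b c d → a + b + (c + d) ≡ a + c + (b + d)
  lemma = solve-∀

∑-*ʳ : ∀ {A : Set} xs {f : A → ℕ} k → ∑ xs (λ x → f x * k) ≡ ∑ xs f * k
∑-*ʳ []           k = refl
∑-*ʳ (x ∷ xs) {f} k = trans (cong (λ s → f x * k + s) (∑-*ʳ xs k)) (sym (*-distribʳ-+ k (f x) (∑ xs f)))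

∑-*ˡ : ∀ {A : Set} xs {f : A → ℕ} k → ∑ xs (λ x → k * f x) ≡ k * ∑ xs f
∑-*ˡ xs {f} k = trans (∑-cong xs (λ {x} _ → *-comm k (f x))) (trans (∑-*ʳ xs k) (*-comm (∑ xs f) k))

∑-const : ∀ {A : Set} (xs : List A) k → ∑ xs (λ _ → k) ≡ length xs * k
∑-const []       k = refl
∑-const (x ∷ xs) k = cong (λ s → k + s) (∑-const xs k)

∑-++ : ∀ {A : Set} xs ys {f : A → ℕ} → ∑ (xs ++ ys) f ≡ ∑ xs f + ∑ ys f
∑-++ xs ys {f} = trans (cong sum (map-++ f xs ys)) (sum-++ (map f xs) (map f ys))

∑-swap : ∀ {A B : Set} xs ys {f : A → B → ℕ} → ∑ xs (λ x → ∑ ys (f x)) ≡ ∑ ys (λ y → ∑ xs (λ x → f x y))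
∑-swap []       ys     = sym (trans (∑-const ys 0) (*-zeroʳ (length ys)))
∑-swap (x ∷ xs) ys {f} = trans (cong (λ s → ∑ ys (f x) + s) (∑-swap xs ys)) (sym (∑-+ ys))

∈⇒≤∑ : ∀ {A : Set} {xs} {x : A} (f : A → ℕ) → x ∈ xs → f x ≤ ∑ xs f
∈⇒≤∑ f (here refl) = m≤m+n _ _
∈⇒≤∑ f (there x∈)  = ≤-trans (∈⇒≤∑ f x∈) (m≤n+m _ _)

𝟙 : {A : Set} → Dec A → ℕ
𝟙 (yes _) = 1
𝟙 (no _)  = 0

𝟙-yes : ∀ {A : Set} (A? : Dec A) → A → 𝟙 A? ≡ 1
𝟙-yes (yes _) _  = refl
𝟙-yes (no ¬a) a = contradiction a ¬a

Separated : ℕ → (ℕ → Set) → Set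
Separated d Q = ∀ x k → Q x → Q (x + k) → d ∣ k

count-window : ∀ {d Q} (Q? : ∀ x → Dec (Q x)) → Separated d Q → ∀ l → l ≤ d → sum (applyUpTo (𝟙 ∘ Q?) l) ≤ 1
count-window Q? sep zero l≤d = z≤n
count-window {d} {Q} Q? sep (suc l) l≤d with Q? 0
... | no _ = count-window {Q = Q ∘ suc} (Q? ∘ suc) (λ x → sep (suc x)) l (<⇒≤ l≤d)
-- After a hit at the start of the window, a second one would lie at a positive distance below `d`.
... | yes q0 = s≤s (none {Q = Q ∘ suc} (Q? ∘ suc) l (λ x x<l q → <⇒≱ (≤-<-trans x<l l≤d) (∣⇒≤ (sep 0 (suc x) q0 q))))
  where
  none : ∀ {Q} (Q? : ∀ x → Dec (Q x)) l → (∀ x → x < l → ¬ Q x) → sum (applyUpTo (𝟙 ∘ Q?) l) ≤ 0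
  none Q? zero    ¬Q = z≤n
  none {Q} Q? (suc l) ¬Q with Q? 0
  ... | yes q = contradiction q (¬Q 0 z<s)
  ... | no _  = none {Q ∘ suc} (Q? ∘ suc) l (λ x x<l → ¬Q (suc x) (s<s x<l))

sum-applyUpTo-+ : ∀ f m n → sum (applyUpTo f (m + n)) ≡ sum (applyUpTo f m) + sum (applyUpTo (λ x → f (m + x)) n)
sum-applyUpTo-+ f zero    n = refl
sum-applyUpTo-+ f (suc m) n = trans (cong (λ s → f 0 + s) (sum-applyUpTo-+ (f ∘ suc) m n)) (sym (+-assoc (f 0) _ _))

count-separated : ∀ {d Q} (Q? : ∀ x → Dec (Q x)) → Separated d Q → ∀ k → ∑ (upTo (k * d)) (𝟙 ∘ Q?) ≤ k
count-separated {d} Q? sep k = subst (_≤ k) (sym (cong sum (map-upTo (𝟙 ∘ Q?) (k * d)))) (blocks Q? sep k)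
  where
  blocks : ∀ {Q} (Q? : ∀ x → Dec (Q x)) → Separated d Q → ∀ k → sum (applyUpTo (𝟙 ∘ Q?) (k * d)) ≤ k
  blocks Q? sep zero = z≤n
  blocks {Q} Q? sep (suc k) = subst (_≤ suc k) (sym (sum-applyUpTo-+ (𝟙 ∘ Q?) d (k * d)))
    (+-mono-≤ (count-window Q? sep d ≤-refl)
              (blocks {λ x → Q (d + x)} (λ x → Q? (d + x))
                (λ x j q q' → sep (d + x) j q (subst Q (sym (+-assoc d x j)) q')) k))

-- Division with the junk value n ÷ 0 = 0.
_÷_ : ℕ → ℕ → ℕ
n ÷ zero  = 0
n ÷ suc d = n / suc d

*÷ : ∀ k {d} → 0 < d → (k * d) ÷ d ≡ k
*÷ k {suc d} _ = m*n/n≡m k (suc d)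

∣⇒÷* : ∀ {d n} → 0 < n → d ∣ n → n ≡ (n ÷ d) * d
∣⇒÷* {d} 0<n (divides k refl) = cong (_* d) (sym (*÷ k {d} (n≢0⇒n>0 λ { refl → <⇒≢ 0<n (sym (*-zeroʳ k)) })))

∣⇒0< : ∀ {d n} → 0 < n → d ∣ n → 0 < d
∣⇒0< 0<n d∣n = n≢0⇒n>0 λ { refl → <⇒≢ 0<n (sym (0∣⇒≡0 d∣n)) }

-- Take `d = gcd D P`: the cofactor `e = D / d` divides `(P / d) M` and is coprime to `P / d`, hence
-- divides `M`.
∣*⇒split : ∀ {P M D} → 0 < P → D ∣ P * M → ∃₂ λ d e → d ∣ P × e ∣ M × D ≡ d * e
∣*⇒split {P} {M} {D} 0<P D∣ with gcd[m,n]∣m D P | gcd[m,n]∣n D P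
... | divides e D≡ | divides P' P≡ =
  g , e , divides P' P≡ , coprime-divisor e⊥P' e∣ , trans D≡ (*-comm e g)
  where
  g = gcd D P
  instance
    g≢0 : NonZero g
    g≢0 = >-nonZero (∣⇒0< 0<P (divides P' P≡))
  e⊥P' : Coprime e P'
  e⊥P' = subst₂ Coprime (trans (cong (_/ g) D≡) (m*n/n≡m e g)) (trans (cong (_/ g) P≡) (m*n/n≡m P' g))
    (Coprime.coprime-/gcd D P)
  lemma : ∀ a b c → a * b * c ≡ a * c * b
  lemma = solve-∀
  e∣ : e ∣ P' * M
  e∣ = *-cancelʳ-∣ g (subst₂ _∣_ D≡ (trans (cong (_* M) P≡) (lemma P' g M)) D∣)

-- The points M s + P y, s < P, y < M, run through all pairs of residues modulo P and modulo M, since a class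
-- modulo d e meets them inside a product set. For fixed s not in a class modulo a divisor of P, the fibre over s
-- has to be covered by the classes modulo d e with e > 1; averaging this over s gives σ(P)/P + σ(M)/M ≥ 3.
¬coverable-sparse : ∀ {P M LP LM} → Coprime P M → 0 < P → 0 < M →
  IsDivisorList P (1 ∷ LP) → IsDivisorList M (1 ∷ LM) →
  P * ∑ LM (M ÷_) + ∑ LP (P ÷_) * M < P * M → ¬ Coverable (P * M)
¬coverable-sparse {P} {M} {LP} {LM} P⊥M 0<P 0<M IP IM sparse (c , cov) = <⇒≱ sparse total
  where
  S T W : ℕ
  S = ∑ LM (M ÷_)
  T = ∑ LP (P ÷_)
  -- In each fibre the classes modulo divisors `e > 1` of `M` contain at most `S` points, so at
  -- least `W` points remain.
  W = M ∸ S
  instance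
    P≢0 : NonZero P
    P≢0 = >-nonZero 0<P

  S+W≡M : S + W ≡ M
  S+W≡M = m+[n∸m]≡n (<⇒≤ (*-cancelˡ-< P S M (≤-<-trans (m≤m+n _ _) sparse)))

  X? : ∀ d e s → Dec (+ d ∣ℤ + (M * s) ℤ.- c (d * e))
  X? d e s = + d ℤ.∣? + (M * s) ℤ.- c (d * e)

  Y? : ∀ d e y → Dec (+ e ∣ℤ + (P * y) ℤ.- c (d * e))
  Y? d e y = + e ℤ.∣? + (P * y) ℤ.- c (d * e)

  count-class : ∀ {n m d} r → 0 < n → d ∣ n → Coprime n m →
    ∑ (upTo n) (λ x → 𝟙 (+ d ℤ.∣? + (m * x) ℤ.- r)) ≤ n ÷ d
  count-class {n} {m} {d} r 0<n d∣n n⊥m =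
    subst (λ k → ∑ (upTo k) (λ x → 𝟙 (Q? x)) ≤ n ÷ d) (sym (∣⇒÷* 0<n d∣n)) (count-separated Q? separated (n ÷ d))
    where
    Q? : ∀ x → Dec (+ d ∣ℤ + (m * x) ℤ.- r)
    Q? x = + d ℤ.∣? + (m * x) ℤ.- r
    -- As `m` is coprime to `d`, the `x` with `m x` in one class modulo `d` are congruent modulo
    -- `d`.
    separated : Separated d (λ x → + d ∣ℤ + (m * x) ℤ.- r)
    separated x k h h' = coprime-divisor (λ (i∣d , i∣m) → n⊥m (∣-trans i∣d d∣n , i∣m))
      (ℤ.∣⇒∣ᵤ (∣-difference {w = + (m * k)} {r} (+ (m * x)) (subst (λ w → + d ∣ℤ + w ℤ.- r) (*-distribˡ-+ m x k) h') h))

  count-X : ∀ {d} e → d ∈ LP → ∑ (upTo P) (λ s → 𝟙 (X? d e s)) ≤ P ÷ d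
  count-X {d} e d∈ = count-class (c (d * e)) 0<P (sound IP (there d∈)) P⊥M

  count-Y : ∀ d {e} → e ∈ LM → ∑ (upTo M) (λ y → 𝟙 (Y? d e y)) ≤ M ÷ e
  count-Y d {e} e∈ = count-class (c (d * e)) 0<M (sound IM (there e∈)) (Coprime.sym P⊥M)

  hit : ∀ s y → ∃₂ λ d e → d ∈ 1 ∷ LP × e ∈ 1 ∷ LM × 1 < d * e ×
    + d ∣ℤ + (M * s) ℤ.- c (d * e) × + e ∣ℤ + (P * y) ℤ.- c (d * e)
  hit s y with D , 1<D , D∣ , h ← cov (+ (M * s) ℤ.+ + (P * y))
    with d , e , d∣P , e∣M , refl ← ∣*⇒split 0<P D∣ =
    d , e , complete IP d∣P , complete IM e∣M , 1<D ,
    ℤ.∣m+n∣n⇒∣m {n = + (P * y)} (subst (+ d ∣ℤ_) (lemma₁ (+ (M * s)) (+ (P * y)) (c (d * e)))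
        (ℤ.∣-trans (ℤ.∣ᵤ⇒∣ (m∣m*n e)) h))
      (ℤ.∣ᵤ⇒∣ (∣m⇒∣m*n y d∣P)) ,
    ℤ.∣m+n∣m⇒∣n {m = + (M * s)} (subst (+ e ∣ℤ_) (lemma₂ (+ (M * s)) (+ (P * y)) (c (d * e)))
        (ℤ.∣-trans (ℤ.∣ᵤ⇒∣ (n∣m*n d)) h))
      (ℤ.∣ᵤ⇒∣ (∣m⇒∣m*n s e∣M))
    where
    lemma₁ : ∀ u v r → u ℤ.+ v ℤ.- r ≡ u ℤ.- r ℤ.+ v
    lemma₁ = solveℤ
    lemma₂ : ∀ u v r → u ℤ.+ v ℤ.- r ≡ u ℤ.+ (v ℤ.- r)
    lemma₂ = solveℤ

  -- What the moduli `d e` with `e ∣ M` are charged for the fibre over `s`. A class modulo `d`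
  -- containing the whole fibre is charged `W` instead of `M`, because `S` is granted to every fibre
  -- anyway. On summing over `s`, each `d` then costs at most `(P / d) (W + S) = (P / d) M`.
  weight : ℕ → ℕ → ℕ
  weight s d = 𝟙 (X? d 1 s) * W + ∑ LM (λ e → 𝟙 (X? d e s) * (M ÷ e))

  fibre : ∀ s → M ≤ S + ∑ LP (weight s)
  fibre s with Any.any? (λ d → X? d 1 s) LP
  ... | yes any with d , d∈ , x ← find any = begin
    M                                ≡⟨ S+W≡M ⟨
    S + W                            ≡⟨ cong (λ k → S + k) (sym (trans (cong (_* W) (𝟙-yes (X? d 1 s) x)) (*-identityˡ W))) ⟩
    S + 𝟙 (X? d 1 s) * W             ≤⟨ +-monoʳ-≤ S (m≤m+n _ _) ⟩
    S + weight s d                   ≤⟨ +-monoʳ-≤ S (∈⇒≤∑ (weight s) d∈) ⟩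
    S + ∑ LP (weight s)              ∎
    where open ≤-Reasoning
  ... | no ¬any = begin
    M                                                ≡⟨ trans (∑-const (upTo M) 1) (trans (*-identityʳ _) (length-upTo M)) ⟨
    ∑ (upTo M) (λ _ → 1)                             ≤⟨ ∑-mono (upTo M) (λ {y} _ → pointwise y) ⟩
    ∑ (upTo M) (λ y → ∑ LM (term y))                 ≡⟨ ∑-swap (upTo M) LM ⟩
    ∑ LM (λ e → ∑ (upTo M) (λ y → term y e))         ≤⟨ ∑-mono LM column ⟩
    ∑ LM (λ e → M ÷ e + ∑ LP (λ d → 𝟙 (X? d e s) * (M ÷ e)))
                                                     ≡⟨ ∑-+ LM ⟩
    S + ∑ LM (λ e → ∑ LP (λ d → 𝟙 (X? d e s) * (M ÷ e)))
                                                     ≡⟨ cong (λ k → S + k) (∑-swap LM LP) ⟩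
    S + ∑ LP (λ d → ∑ LM (λ e → 𝟙 (X? d e s) * (M ÷ e)))
                                                     ≤⟨ +-monoʳ-≤ S (∑-mono LP (λ _ → m≤n+m _ _)) ⟩
    S + ∑ LP (weight s)                              ∎
    where
    open ≤-Reasoning
    term : ℕ → ℕ → ℕ
    term y e = 𝟙 (Y? 1 e y) + ∑ LP (λ d → 𝟙 (X? d e s) * 𝟙 (Y? d e y))

    pointwise : ∀ y → 1 ≤ ∑ LM (term y)
    pointwise y with hit s y
    ... | _ , _ , here refl , here refl , 1<1 , _ = contradiction refl (<⇒≢ 1<1)
    ... | _ , _ , there d∈ , here refl , _ , x , _ = contradiction (lose d∈ x) ¬any
    ... | _ , e , here refl , there e∈ , _ , _ , h = ≤-trans
          (≤-trans (≤-reflexive (sym (𝟙-yes (Y? 1 e y) h))) (m≤m+n _ _)) (∈⇒≤∑ (term y) e∈)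
    ... | d , e , there d∈ , there e∈ , _ , x , h = ≤-trans
          (≤-trans (≤-reflexive (sym (cong₂ _*_ (𝟙-yes (X? d e s) x) (𝟙-yes (Y? d e y) h))))
            (≤-trans (∈⇒≤∑ (λ d → 𝟙 (X? d e s) * 𝟙 (Y? d e y)) d∈) (m≤n+m _ (𝟙 (Y? 1 e y)))))
          (∈⇒≤∑ (term y) e∈)

    column : ∀ {e} → e ∈ LM →
      ∑ (upTo M) (λ y → term y e) ≤ M ÷ e + ∑ LP (λ d → 𝟙 (X? d e s) * (M ÷ e))
    column {e} e∈ = begin
      ∑ (upTo M) (λ y → term y e)
        ≡⟨ ∑-+ (upTo M) ⟩
      ∑ (upTo M) (λ y → 𝟙 (Y? 1 e y)) + ∑ (upTo M) (λ y → ∑ LP (λ d → 𝟙 (X? d e s) * 𝟙 (Y? d e y)))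
        ≤⟨ +-mono-≤ (count-Y 1 e∈) (≤-reflexive (∑-swap (upTo M) LP)) ⟩
      M ÷ e + ∑ LP (λ d → ∑ (upTo M) (λ y → 𝟙 (X? d e s) * 𝟙 (Y? d e y)))
        ≤⟨ +-monoʳ-≤ (M ÷ e) (∑-mono LP (λ {d} _ → ≤-trans (≤-reflexive (∑-*ˡ (upTo M) (𝟙 (X? d e s))))
             (*-monoʳ-≤ (𝟙 (X? d e s)) (count-Y d e∈)))) ⟩
      M ÷ e + ∑ LP (λ d → 𝟙 (X? d e s) * (M ÷ e)) ∎

  average : ∀ {d} → d ∈ LP → ∑ (upTo P) (λ s → weight s d) ≤ (P ÷ d) * M
  average {d} d∈ = begin
    ∑ (upTo P) (λ s → weight s d)
      ≡⟨ ∑-+ (upTo P) ⟩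
    ∑ (upTo P) (λ s → 𝟙 (X? d 1 s) * W) + ∑ (upTo P) (λ s → ∑ LM (λ e → 𝟙 (X? d e s) * (M ÷ e)))
      ≡⟨ cong₂ _+_ (∑-*ʳ (upTo P) W) (∑-swap (upTo P) LM) ⟩
    ∑ (upTo P) (λ s → 𝟙 (X? d 1 s)) * W + ∑ LM (λ e → ∑ (upTo P) (λ s → 𝟙 (X? d e s) * (M ÷ e)))
      ≤⟨ +-mono-≤ (*-monoˡ-≤ W (count-X 1 d∈)) (∑-mono LM (λ {e} _ →
           ≤-trans (≤-reflexive (∑-*ʳ (upTo P) (M ÷ e))) (*-monoˡ-≤ (M ÷ e) (count-X e d∈)))) ⟩
    (P ÷ d) * W + ∑ LM (λ e → (P ÷ d) * (M ÷ e))
      ≡⟨ cong (λ k → (P ÷ d) * W + k) (∑-*ˡ LM (P ÷ d)) ⟩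
    (P ÷ d) * W + (P ÷ d) * S
      ≡⟨ *-distribˡ-+ (P ÷ d) W S ⟨
    (P ÷ d) * (W + S)
      ≡⟨ cong ((P ÷ d) *_) (trans (+-comm W S) S+W≡M) ⟩
    (P ÷ d) * M ∎
    where open ≤-Reasoning

  total : P * M ≤ P * S + T * M
  total = begin
    P * M                                              ≡⟨ trans (∑-const (upTo P) M) (cong (_* M) (length-upTo P)) ⟨
    ∑ (upTo P) (λ _ → M)                               ≤⟨ ∑-mono (upTo P) (λ {s} _ → fibre s) ⟩
    ∑ (upTo P) (λ s → S + ∑ LP (weight s))             ≡⟨ ∑-+ (upTo P) ⟩
    ∑ (upTo P) (λ _ → S) + ∑ (upTo P) (λ s → ∑ LP (weight s))
      ≡⟨ cong₂ _+_ (trans (∑-const (upTo P) S) (cong (_* S) (length-upTo P))) (∑-swap (upTo P) LP) ⟩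
    P * S + ∑ LP (λ d → ∑ (upTo P) (λ s → weight s d)) ≤⟨ +-monoʳ-≤ (P * S) (∑-mono LP average) ⟩
    P * S + ∑ LP (λ d → (P ÷ d) * M)                   ≡⟨ cong (λ k → P * S + k) (∑-*ʳ LP M) ⟩
    P * S + T * M                                      ∎
    where open ≤-Reasoning

-- Abundancy and odd numbers

-- Passing from `m p^a` to `m p^(a+1)` multiplies the codivisor of an old divisor by `p`, and the
-- codivisor of `e p^(a+1)` is `m / e`. As these sums are σ, this reads σ(m p^(a+1)) = p σ(m p^a) +
-- σ(m).
∑-divisorsTimes : ∀ {p m L} → Prime p → ¬ p ∣ m → 0 < m → IsDivisorList m L → ∀ a →
  ∑ (divisorsTimes L p (suc a)) ((m * p ^ suc a) ÷_) ≡ p * ∑ (divisorsTimes L p a) ((m * p ^ a) ÷_) + ∑ L (m ÷_)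
∑-divisorsTimes {p} {m} {L} pr p∤m 0<m I a = begin
  ∑ (divisorsTimes L p a ++ map (_* q) L) ((m * q) ÷_)
    ≡⟨ ∑-++ (divisorsTimes L p a) (map (_* q) L) ⟩
  ∑ (divisorsTimes L p a) ((m * q) ÷_) + ∑ (map (_* q) L) ((m * q) ÷_)
    ≡⟨ cong₂ _+_ (trans (∑-cong (divisorsTimes L p a) old) (∑-*ˡ (divisorsTimes L p a) p))
                 (trans (cong sum (sym (map-∘ L))) (∑-cong L new)) ⟩
  p * ∑ (divisorsTimes L p a) ((m * p ^ a) ÷_) + ∑ L (m ÷_) ∎
  where
  open ≡-Reasoning
  q : ℕ
  q = p ^ suc a
  instance
    p≢0 : NonZero p
    p≢0 = prime⇒nonZero pr
    p^a≢0 : NonZero (p ^ a)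
    p^a≢0 = m^n≢0 p a
    q≢0 : NonZero q
    q≢0 = m^n≢0 p (suc a)
    m≢0 : NonZero m
    m≢0 = >-nonZero 0<m
    mp^a≢0 : NonZero (m * p ^ a)
    mp^a≢0 = m*n≢0 m (p ^ a)
  old : ∀ {d} → d ∈ divisorsTimes L p a → (m * q) ÷ d ≡ p * ((m * p ^ a) ÷ d)
  old {d} d∈ with divides k eq ← sound (divisorList-*^ pr p∤m 0<m I a) d∈ =
    trans (cong (_÷ d) (trans (lemma₁ m p (p ^ a)) (trans (cong (p *_) eq) (sym (*-assoc p k d)))))
      (trans (*÷ (p * k) 0<d) (cong (p *_) (sym (trans (cong (_÷ d) eq) (*÷ k 0<d)))))
    where
    0<d : 0 < d
    0<d = ∣⇒0< (>-nonZero⁻¹ (m * p ^ a)) (divides k eq)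
    lemma₁ : ∀ m p x → m * (p * x) ≡ p * (m * x)
    lemma₁ = solve-∀
  new : ∀ {d} → d ∈ L → (m * q) ÷ (d * q) ≡ m ÷ d
  new {d} d∈ with divides k refl ← sound I d∈ =
    trans (trans (cong (_÷ (d * q)) (*-assoc k d q))
      (*÷ k (>-nonZero⁻¹ (d * q) {{m*n≢0 d q {{>-nonZero 0<d}}}}))) (sym (*÷ k 0<d))
    where
    0<d : 0 < d
    0<d = ∣⇒0< 0<m (n∣m*n k)

-- From Σ_{i ≤ a} p^(-i) < p / (p - 1) ≤ (k + 1) / k.
∑-divisorsTimes-≤ : ∀ {p m L} k → Prime p → suc k ≤ p → ¬ p ∣ m → 0 < m → IsDivisorList m L → ∀ a →
  k * ∑ (divisorsTimes L p a) ((m * p ^ a) ÷_) + ∑ L (m ÷_) ≤ suc k * p ^ a * ∑ L (m ÷_)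
∑-divisorsTimes-≤ {p} {m} {L} k pr k<p p∤m 0<m I zero = ≤-reflexive
  (trans (cong (λ n → k * ∑ L (n ÷_) + ∑ L (m ÷_)) (*-identityʳ m)) (lemma k (∑ L (m ÷_))))
  where
  lemma : ∀ k h → k * h + h ≡ suc k * 1 * h
  lemma = solve-∀
∑-divisorsTimes-≤ {p} {m} {L} k pr k<p p∤m 0<m I (suc a) = begin
  k * ∑ (divisorsTimes L p (suc a)) ((m * p ^ suc a) ÷_) + h
    ≡⟨ cong (λ x → k * x + h) (∑-divisorsTimes pr p∤m 0<m I a) ⟩
  k * (p * H + h) + h         ≡⟨ lemma₁ k p H h ⟩
  -- The summand `h` in the claim carries the induction: `suc k ≤ p` turns `suc k * h` into `p * h`,
  -- as the hypothesis needs.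
  p * (k * H) + suc k * h     ≤⟨ +-monoʳ-≤ (p * (k * H)) (*-monoˡ-≤ h k<p) ⟩
  p * (k * H) + p * h         ≡⟨ *-distribˡ-+ p (k * H) h ⟨
  p * (k * H + h)             ≤⟨ *-monoʳ-≤ p (∑-divisorsTimes-≤ k pr k<p p∤m 0<m I a) ⟩
  p * (suc k * p ^ a * h)     ≡⟨ lemma₂ p k (p ^ a) h ⟩
  suc k * p ^ suc a * h       ∎
  where
  open ≤-Reasoning
  h = ∑ L (m ÷_)
  H = ∑ (divisorsTimes L p a) ((m * p ^ a) ÷_)
  lemma₁ : ∀ k p H h → k * (p * H + h) + h ≡ p * (k * H) + suc k * h
  lemma₁ = solve-∀
  lemma₂ : ∀ p k x h → p * (suc k * x * h) ≡ suc k * (p * x) * h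
  lemma₂ = solve-∀

-- The density criterion sums over the divisors other than 1, so 1 is kept at the head, ready to be
-- split off.
divisorsTimes-1∷ : ∀ L p a → ∃[ L' ] divisorsTimes (1 ∷ L) p a ≡ 1 ∷ L'
divisorsTimes-1∷ L p zero = L , refl
divisorsTimes-1∷ L p (suc a) with L' , eq ← divisorsTimes-1∷ L p a =
  L' ++ map (_* p ^ suc a) (1 ∷ L) , cong (_++ map (_* p ^ suc a) (1 ∷ L)) eq

-- σ(m)/m ≤ k/l
record AbundancyBound (k l m : ℕ) : Set where
  field
    {others}      : List ℕ
    isDivisorList : IsDivisorList m (1 ∷ others)
    positive      : 0 < m
    bound         : l * ∑ (1 ∷ others) (m ÷_) ≤ k * m

abundancy-1 : AbundancyBound 1 1 1
abundancy-1 = record { isDivisorList = divisorList-1 ; positive = z<s ; bound = s≤s z≤n }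

-- A prime `p ≥ s + 1` contributes the factor σ(p^a)/p^a < p/(p - 1) ≤ (s + 1)/s. Stating it with a
-- lower bound `s + 1` gives one numerical constant for all primes from there on.
abundancy-*^ : ∀ {k l m p} s → Prime p → suc s ≤ p → ¬ p ∣ m → AbundancyBound k l m → ∀ a →
  AbundancyBound (suc s * k) (s * l) (m * p ^ a)
abundancy-*^ {k} {l} {m} {p} s pr s<p p∤m B a with L' , eq ← divisorsTimes-1∷ (AbundancyBound.others B) p a = record
  { isDivisorList = subst (IsDivisorList (m * p ^ a)) eq (divisorList-*^ pr p∤m 0<m I a)
  ; positive      = >-nonZero⁻¹ (m * p ^ a) {{m*n≢0 m (p ^ a) {{>-nonZero 0<m}} {{m^n≢0 p a {{prime⇒nonZero pr}}}}}}
  ; bound         = subst (λ L → s * l * ∑ L ((m * p ^ a) ÷_) ≤ suc s * k * (m * p ^ a)) eq (begin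
      s * l * H                 ≡⟨ lemma₁ s l H ⟩
      l * (s * H)               ≤⟨ *-monoʳ-≤ l (≤-trans (m≤m+n (s * H) h) (∑-divisorsTimes-≤ s pr s<p p∤m 0<m I a)) ⟩
      l * (suc s * p ^ a * h)   ≡⟨ lemma₂ l s (p ^ a) h ⟩
      suc s * p ^ a * (l * h)   ≤⟨ *-monoʳ-≤ (suc s * p ^ a) bound ⟩
      suc s * p ^ a * (k * m)   ≡⟨ lemma₃ s (p ^ a) k m ⟩
      suc s * k * (m * p ^ a)   ∎)
  }
  where
  open ≤-Reasoning
  open AbundancyBound B renaming (isDivisorList to I; positive to 0<m)
  h = ∑ (1 ∷ others) (m ÷_)
  H = ∑ (divisorsTimes (1 ∷ others) p a) ((m * p ^ a) ÷_)
  lemma₁ : ∀ s l H → s * l * H ≡ l * (s * H)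
  lemma₁ = solve-∀
  lemma₂ : ∀ l s x h → l * (suc s * x * h) ≡ suc s * x * (l * h)
  lemma₂ = solve-∀
  lemma₃ : ∀ s x k m → suc s * x * (k * m) ≡ suc s * k * (m * x)
  lemma₃ = solve-∀

coprime-^ : ∀ {m p} → Coprime m p → ∀ a → Coprime m (p ^ a)
coprime-^ m⊥p zero    (i∣m , i∣1) = ∣1⇒≡1 i∣1
coprime-^ m⊥p (suc a) (i∣m , i∣p^) =
  coprime-^ m⊥p a (i∣m , coprime-divisor (λ (j∣i , j∣p) → m⊥p (∣-trans j∣i i∣m , j∣p)) i∣p^)

prime∤1 : ∀ {p} → Prime p → ¬ p ∣ 1
prime∤1 pr p∣1 = <⇒≱ (nonTrivial⇒n>1 _ {{prime⇒nonTrivial pr}}) (∣⇒≤ p∣1)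

-- For odd p one has σ(p^a)/p^a < 3/2, so the criterion σ(P)/P + σ(M)/M < 3 applies.
¬coverable-odd-*^ : ∀ {p m} → Prime p → 3 ≤ p → ¬ p ∣ m → AbundancyBound 3 2 m → ∀ a → ¬ Coverable (m * p ^ a)
¬coverable-odd-*^ {p} {m} pr 3≤p p∤m B a = subst (λ n → ¬ Coverable n) (*-comm P m)
  (¬coverable-sparse (Coprime.sym (coprime-^ (prime∤⇒coprime pr p∤m) a)) 0<P 0<m IP IM sparse)
  where
  open AbundancyBound B renaming (isDivisorList to IM; positive to 0<m; others to LM; bound to boundM)
  P : ℕ
  P = p ^ a
  instance
    P≢0 : NonZero P
    P≢0 = m^n≢0 p a {{prime⇒nonZero pr}}
  0<P : 0 < P
  0<P = >-nonZero⁻¹ P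
  LP : List ℕ
  LP = proj₁ (divisorsTimes-1∷ [] p a)
  LP≡ : divisorsTimes (1 ∷ []) p a ≡ 1 ∷ LP
  LP≡ = proj₂ (divisorsTimes-1∷ [] p a)
  IP : IsDivisorList P (1 ∷ LP)
  IP = subst₂ IsDivisorList (*-identityˡ P) LP≡ (divisorList-*^ pr (prime∤1 pr) z<s divisorList-1 a)
  S T : ℕ
  S = ∑ LM (m ÷_)
  T = ∑ LP (P ÷_)

  -- The divisor 1 accounts for `m` in σ(m) ≤ 3m/2, which leaves `S ≤ m / 2`.
  2S≤m : 2 * S ≤ m
  2S≤m = +-cancelˡ-≤ (2 * m) (2 * S) m (begin
    2 * m + 2 * S        ≡⟨ *-distribˡ-+ 2 m S ⟨
    2 * (m + S)          ≡⟨ cong (λ x → 2 * (x + S)) (trans (cong (_÷ 1) (sym (*-identityʳ m))) (*÷ m z<s)) ⟨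
    2 * (m ÷ 1 + S)      ≤⟨ boundM ⟩
    3 * m                ≡⟨ lemma m ⟩
    2 * m + m            ∎)
    where
    open ≤-Reasoning
    lemma : ∀ m → 3 * m ≡ 2 * m + m
    lemma = solve-∀

  2T<P : 2 * T < P
  2T<P = +-cancelˡ-≤ (2 * P) (suc (2 * T)) P (begin
    2 * P + suc (2 * T)         ≡⟨ lemma₁ P T ⟩
    2 * (P + T) + 1             ≡⟨ cong (λ x → 2 * (x + T) + 1) (trans (cong (_÷ 1) (sym (*-identityʳ P))) (*÷ P z<s)) ⟨
    2 * ∑ (1 ∷ LP) (P ÷_) + 1
      ≡⟨ cong₂ (λ L n → 2 * ∑ L (n ÷_) + 1) LP≡ (*-identityˡ P) ⟨
    -- The final 1 is σ(1), the extra summand in `∑-divisorsTimes-≤`; it makes `2T<P` strict.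
    2 * ∑ (divisorsTimes (1 ∷ []) p a) ((1 * P) ÷_) + 1
      ≤⟨ ∑-divisorsTimes-≤ 2 pr 3≤p (prime∤1 pr) z<s divisorList-1 a ⟩
    3 * P * 1                   ≡⟨ lemma₂ P ⟩
    2 * P + P                   ∎)
    where
    open ≤-Reasoning
    lemma₁ : ∀ P T → 2 * P + suc (2 * T) ≡ 2 * (P + T) + 1
    lemma₁ = solve-∀
    lemma₂ : ∀ P → 3 * P * 1 ≡ 2 * P + P
    lemma₂ = solve-∀

  sparse : P * S + T * m < P * m
  sparse = *-cancelˡ-< 2 (P * S + T * m) (P * m) (begin-strict
    2 * (P * S + T * m)         ≡⟨ lemma₁ P S T m ⟩
    P * (2 * S) + 2 * T * m     <⟨ +-mono-≤-< (*-monoʳ-≤ P 2S≤m) (*-monoˡ-< m {{>-nonZero 0<m}} 2T<P) ⟩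
    P * m + P * m               ≡⟨ lemma₂ (P * m) ⟩
    2 * (P * m)                 ∎)
    where
    open ≤-Reasoning
    lemma₁ : ∀ P S T m → 2 * (P * S + T * m) ≡ P * (2 * S) + 2 * T * m
    lemma₁ = solve-∀
    lemma₂ : ∀ x → x + x ≡ 2 * x
    lemma₂ = solve-∀

∤-* : ∀ {p m n} → Prime p → ¬ p ∣ m → ¬ p ∣ n → ¬ p ∣ m * n
∤-* {m = m} {n} pr p∤m p∤n p∣mn = [ p∤m , p∤n ]′ (euclidsLemma m n pr p∣mn)

prime∣prime⇒≡ : ∀ {p q} → Prime p → Prime q → p ∣ q → p ≡ q
prime∣prime⇒≡ pp pq p∣q with prime⇒irreducible pq p∣q
... | inj₁ refl = contradiction ∣-refl (prime∤1 pp)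
... | inj₂ p≡q  = p≡q

∤-^ : ∀ {p q} → Prime p → Prime q → p ≢ q → ∀ a → ¬ p ∣ q ^ a
∤-^ pp pq p≢q zero    = prime∤1 pp
∤-^ pp pq p≢q (suc a) = ∤-* pp (p≢q ∘ prime∣prime⇒≡ pp pq) (∤-^ pp pq p≢q a)

∤-*^ : ∀ {p q m} → Prime p → Prime q → p ≢ q → ¬ p ∣ m → ∀ a → ¬ p ∣ m * q ^ a
∤-*^ pp pq p≢q p∤m a = ∤-* pp p∤m (∤-^ pp pq p≢q a)

abundancy-weaken : ∀ {k l m} k' l' .{{_ : NonZero l}} → k * l' ≤ k' * l → AbundancyBound k l m → AbundancyBound k' l' m
abundancy-weaken {k} {l} {m} k' l' kl'≤k'l B = record
  { isDivisorList = AbundancyBound.isDivisorList B ; positive = AbundancyBound.positive B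
  ; bound = *-cancelʳ-≤ (l' * h) (k' * m) l (begin
      l' * h * l      ≡⟨ lemma l' h l ⟩
      l' * (l * h)    ≤⟨ *-monoʳ-≤ l' bound ⟩
      l' * (k * m)    ≡⟨ lemma' l' k m ⟩
      k * l' * m      ≤⟨ *-monoˡ-≤ m kl'≤k'l ⟩
      k' * l * m      ≡⟨ lemma'' k' l m ⟩
      k' * m * l      ∎)
  }
  where
  open ≤-Reasoning
  open AbundancyBound B using (others; bound)
  h = ∑ (1 ∷ others) (m ÷_)
  lemma : ∀ a b c → a * b * c ≡ a * (c * b)
  lemma = solve-∀
  lemma' : ∀ a b c → a * (b * c) ≡ b * a * c
  lemma' = solve-∀
  lemma'' : ∀ a b c → a * b * c ≡ a * c * b
  lemma'' = solve-∀

abundancy-^ : ∀ {p} s → Prime p → suc s ≤ p → ∀ a → AbundancyBound (suc s * 1) (s * 1) (p ^ a)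
abundancy-^ {p} s pr s<p a = subst (AbundancyBound _ _) (*-identityˡ (p ^ a))
  (abundancy-*^ s pr s<p (prime∤1 pr) abundancy-1 a)

-- 5/4 < 3/2, in integers `10 ≤ 12`. A prime 3, if present, has to be the separated prime `p`.
¬coverable-odd₂ : ∀ {p q} → Prime p → Prime q → 3 ≤ p → 5 ≤ q → p ≢ q → ∀ a b → ¬ Coverable (q ^ b * p ^ a)
¬coverable-odd₂ pp pq 3≤p 5≤q p≢q a b = ¬coverable-odd-*^ pp 3≤p (∤-^ pp pq p≢q b)
  (abundancy-weaken 3 2 (m≤m+n 10 2) (abundancy-^ 4 pq 5≤q b)) a

-- 5/4 * 7/6 = 35/24 < 3/2
¬coverable-odd₃ : ∀ {p q r} → Prime p → Prime q → Prime r → 3 ≤ p → 5 ≤ q → 7 ≤ r → p ≢ q → p ≢ r → r ≢ q →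
  ∀ a b c → ¬ Coverable (q ^ b * r ^ c * p ^ a)
¬coverable-odd₃ pp pq pr 3≤p 5≤q 7≤r p≢q p≢r r≢q a b c =
  ¬coverable-odd-*^ pp 3≤p (∤-*^ pp pr p≢r (∤-^ pp pq p≢q b) c)
    (abundancy-weaken 3 2 (m≤m+n 70 2) (abundancy-*^ 6 pr 7≤r (∤-^ pr pq r≢q b) (abundancy-^ 4 pq 5≤q b) c)) a

divisorCount-^ : ∀ {p} → Prime p → ∀ a → DivisorCount (p ^ a) (suc a)
divisorCount-^ {p} pr a = subst₂ DivisorCount (*-identityˡ (p ^ a)) (*-identityˡ (suc a))
  (divisorCount-*^ pr (prime∤1 pr) divisorCount-1 a)

¬coverable-^ : ∀ {p} → Prime p → ∀ a → ¬ Coverable (p ^ a)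
¬coverable-^ {p} pr a = subst (λ n → ¬ Coverable n) (*-identityˡ (p ^ a))
  (¬coverable-*^ pr (prime∤1 pr) divisorCount-1 (nonTrivial⇒n>1 p {{prime⇒nonTrivial pr}}) ¬coverable-1 a)

-- Construction over `m = 1`, where `p - 1 ≤ τ(1) = 1` singles out the prime 2; every cover built
-- below starts here.
nearCoverable-2^ : ∀ a → NearCoverable (2 ^ a)
nearCoverable-2^ a = subst NearCoverable (*-identityˡ (2 ^ a))
  (nearCoverable-*^ prime[2] (prime∤1 prime[2]) divisorCount-1 ≤-refl nearCoverable-1 a)

prime[3] : Prime 3
prime[3] = from-yes (prime? 3)

prime[5] : Prime 5
prime[5] = from-yes (prime? 5)

prime[7] : Prime 7
prime[7] = from-yes (prime? 7)

-- Primitive covering numbers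

mkPrimitive : ∀ {n} → 0 < n → Coverable n → (∀ {d} → d ∣ n → d < n → ¬ Coverable d) → PrimitiveCoveringNumber n
mkPrimitive 0<n cov ¬cov = coverable⇒covering 0<n cov , λ d d∣n d<n D → ¬cov d∣n d<n (covering⇒coverable D)

-- The predicate `Q` is left open so that the lemma can be nested: peeling off `p` and then `q`
-- sorts proper divisors by whether they lose a factor `p`, a factor `q` or a part of the remaining
-- cofactor.
proper-*^ : ∀ {p m} a (Q : ℕ → Set) → Prime p → ¬ p ∣ m →
  (∀ {d} → d ∣ m * p ^ a → Q d) → (∀ {e} → e ∣ m → e < m → Q (e * p ^ suc a)) →
  ∀ {d} → d ∣ m * p ^ suc a → d < m * p ^ suc a → Q d
proper-*^ {p} {m} a Q pr p∤m old new {d} d∣ d< with ∣m*p^⇒ pr p∤m a d∣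
... | inj₁ h = old h
... | inj₂ (e , e∣m , refl) = new e∣m (*-cancelʳ-< (p ^ suc a) e m d<)

proper-^ : ∀ {p d} a → Prime p → d ∣ p ^ suc a → d < p ^ suc a → d ∣ p ^ a
proper-^ {p} {d} a pr d∣ d< = proper-*^ a (_∣ p ^ a) pr (prime∤1 pr)
  (λ {d} → subst (d ∣_) (*-identityˡ (p ^ a)))
  (λ e∣1 e<1 → contradiction (∣1⇒≡1 e∣1) (<⇒≢ e<1))
  (subst (d ∣_) (sym (*-identityˡ _)) d∣) (subst (d <_) (sym (*-identityˡ _)) d<)

-- τ(2^(p-1)) = p is just enough for the moduli `e p` to close the cover, and τ(2^(p-2)) = p - 1 is
-- one too few.
primitive-2^*p : ∀ {p} → Prime p → p ≢ 2 → PrimitiveCoveringNumber (2 ^ (p ∸ 1) * p)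
primitive-2^*p {zero} pr = ⊥-elim (<⇒≱ (nonTrivial⇒n>1 0 {{prime⇒nonTrivial pr}}) z≤n)
primitive-2^*p {suc zero} pr = ⊥-elim (<⇒≱ (nonTrivial⇒n>1 1 {{prime⇒nonTrivial pr}}) (s≤s z≤n))
primitive-2^*p {p@(suc (suc k))} pr p≢2 = subst (λ x → PrimitiveCoveringNumber (2 ^ suc k * x)) (*-identityʳ p)
  (mkPrimitive (positive (divisorCount-*^ pr (p∤2^ (suc k)) (divisorCount-^ prime[2] (suc k)) 1))
    (subst (λ x → Coverable (2 ^ suc k * x)) (sym (*-identityʳ p))
      (coverable-* pr (p∤2^ (suc k)) (divisorCount-^ prime[2] (suc k)) ≤-refl (nearCoverable-2^ (suc k))))
    (proper-*^ 0 (λ d → ¬ Coverable d) pr (p∤2^ (suc k))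
      (λ d∣ cov → ¬coverable-^ prime[2] (suc k) (subst Coverable (*-identityʳ (2 ^ suc k)) (coverable-∣ d∣ cov)))
      (λ e∣ e< cov → ¬coverable-*^ pr (p∤2^ k) (divisorCount-^ prime[2] k) ≤-refl (¬coverable-^ prime[2] k) 1
        (coverable-∣ (*-monoˡ-∣ (p ^ 1) (proper-^ k prime[2] e∣ e<)) cov))))
  where
  p∤2^ : ∀ a → ¬ p ∣ 2 ^ a
  p∤2^ = ∤-^ pr prime[2] p≢2

coverable-*^* : ∀ {m t q p} → Prime q → Prime p → ¬ q ∣ m → ¬ p ∣ m → p ≢ q → DivisorCount m t → NearCoverable m →
  ∀ b → q ≤ 1 + t → p ≤ t * suc b → Coverable (m * q ^ b * p)
coverable-*^* pq pp q∤m p∤m p≢q D near b q≤ p≤ =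
  coverable-* pp (∤-*^ pp pq p≢q p∤m b) (divisorCount-*^ pq q∤m D b) p≤ (nearCoverable-*^ pq q∤m D q≤ near b)

¬coverable-*^*^ : ∀ {m t q p} → Prime q → Prime p → ¬ q ∣ m → ¬ p ∣ m → p ≢ q → DivisorCount m t → ¬ Coverable m →
  ∀ b c → t < q → t * suc b < p → ¬ Coverable (m * q ^ b * p ^ c)
¬coverable-*^*^ pq pp q∤m p∤m p≢q D ¬m b c t<q tb<p =
  ¬coverable-*^ pp (∤-*^ pp pq p≢q p∤m b) (divisorCount-*^ pq q∤m D b) tb<p (¬coverable-*^ pq q∤m D t<q ¬m b) c

-- The two bounds on `p` make `suc b` the least exponent with τ(m q^(suc b)) ≥ p, for `q = t + 1`.
-- Divisors that lose `p` or a factor `q` are excluded here by reduction; those that lose a part of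
-- `m` depend on `m` and are left to the caller.
primitive-*^* : ∀ {m t p} → Prime (suc t) → Prime p → ¬ suc t ∣ m → ¬ p ∣ m → p ≢ suc t →
  DivisorCount m t → NearCoverable m → ¬ Coverable m → ∀ b → t * suc b < p → p ≤ t * suc (suc b) →
  (∀ {f} → f ∣ m → f < m → ¬ Coverable (f * suc t ^ suc b * p ^ 1)) →
  PrimitiveCoveringNumber (m * suc t ^ suc b * p)
primitive-*^* {m} {t} {p} pq pp q∤m p∤m p≢q D near ¬m b tb<p p≤ ¬f =
  subst (λ x → PrimitiveCoveringNumber (m * q ^ suc b * x)) (*-identityʳ p)
    (mkPrimitive (positive (divisorCount-*^ pp p∤N DN 1))
      (subst (λ x → Coverable (m * q ^ suc b * x)) (sym (*-identityʳ p))
        (coverable-*^* pq pp q∤m p∤m p≢q D near (suc b) ≤-refl p≤))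
      (proper-*^ 0 (λ d → ¬ Coverable d) pp p∤N
        (λ d∣ cov → ¬coverable-*^ pq q∤m D ≤-refl ¬m (suc b)
          (subst Coverable (*-identityʳ (m * q ^ suc b)) (coverable-∣ d∣ cov)))
        (proper-*^ b (λ e → ¬ Coverable (e * p ^ 1)) pq q∤m
          (λ e∣ cov → ¬coverable-*^*^ pq pp q∤m p∤m p≢q D ¬m b 1 ≤-refl tb<p
            (coverable-∣ (*-monoˡ-∣ (p ^ 1) e∣) cov))
          ¬f)))
  where
  q = suc t
  DN = divisorCount-*^ pq q∤m D (suc b)
  p∤N : ¬ p ∣ m * q ^ suc b
  p∤N = ∤-*^ pp pq p≢q p∤m (suc b)

-- Arithmetic of the exponents

floor-< : ∀ k p .{{_ : NonZero k}} → 0 < p → k * ((p ∸ 1) / k) < p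
floor-< k (suc p) _ = s≤s (≤-trans (≤-reflexive (*-comm k (p / k))) (m/n*n≤m p k))

floor-≥ : ∀ k p .{{_ : NonZero k}} → p ≤ k * suc ((p ∸ 1) / k)
floor-≥ k zero = z≤n
floor-≥ k (suc p) = begin-strict
  p                          ≡⟨ m≡m%n+[m/n]*n p k ⟩
  p % k + (p / k) * k        <⟨ +-monoˡ-< ((p / k) * k) (m%n<n p k) ⟩
  suc (p / k) * k            ≡⟨ *-comm (suc (p / k)) k ⟩
  k * suc (p / k)            ∎
  where open ≤-Reasoning

-- From `(t + s) b + 1 ≤ p` one gets `(t + s) t (b + 1) ≤ t p + t (t + s) - t`, which is below
-- `(t + s) p` as soon as `t (t + s) < s n + t`; for numerals this is decided at the call. It serves
-- to replace `m` with `t + s` divisors by a proper divisor of `m` with `t` divisors.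
floor-bound : ∀ t s n b {p} .{{_ : NonZero (t + s)}} {_ : True (t * (t + s) <? s * n + t)} →
  n ≤ p → (t + s) * b < p → t * suc b < p
floor-bound t s n b {p} {ok} n≤p kb<p = *-cancelˡ-< (t + s) (t * suc b) p
  (+-cancelʳ-< t ((t + s) * (t * suc b)) ((t + s) * p) (begin-strict
    (t + s) * (t * suc b) + t            ≡⟨ lemma₁ t s b ⟩
    t * suc ((t + s) * b) + t * (t + s)  ≤⟨ +-monoˡ-≤ (t * (t + s)) (*-monoʳ-≤ t kb<p) ⟩
    t * p + t * (t + s)                  <⟨ +-monoʳ-< (t * p) (toWitness ok) ⟩
    t * p + (s * n + t)                  ≤⟨ +-monoʳ-≤ (t * p) (+-monoˡ-≤ t (*-monoʳ-≤ s n≤p)) ⟩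
    t * p + (s * p + t)                  ≡⟨ lemma₂ t s p ⟩
    (t + s) * p + t                      ∎))
  where
  open ≤-Reasoning
  lemma₁ : ∀ t s b → (t + s) * (t * suc b) + t ≡ t * suc ((t + s) * b) + t * (t + s)
  lemma₁ = solve-∀
  lemma₂ : ∀ t s p → t * p + (s * p + t) ≡ (t + s) * p + t
  lemma₂ = solve-∀

-- Families with three or four prime divisors

primitive-2*3^*p : ∀ {p} → Prime p → 3 < p → PrimitiveCoveringNumber (2 * 3 ^ ((p ∸ 1) / 2) * p)
primitive-2*3^*p {p} pp 3<p = go ((p ∸ 1) / 2) (floor-< 2 p (≤-trans (s≤s z≤n) 3<p)) (floor-≥ 2 p)
  where
  go : ∀ b → 2 * b < p → p ≤ 2 * suc b → PrimitiveCoveringNumber (2 * 3 ^ b * p)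
  go zero    _    p≤2 = contradiction (≤-trans 3<p p≤2) (from-no (4 ≤? 2))
  go (suc b) kb<p p≤  = primitive-*^* prime[3] pp (from-no (3 ∣? 2)) p∤2 p≢3 (divisorCount-^ prime[2] 1)
    (nearCoverable-2^ 1) (¬coverable-^ prime[2] 1) b kb<p p≤
    (λ f∣2 f<2 cov → ¬coverable-*^*^ prime[3] pp (prime∤1 prime[3]) (prime∤1 pp) p≢3 divisorCount-1 ¬coverable-1
      (suc b) 1 (s≤s (s≤s z≤n)) (floor-bound 1 1 4 (suc b) 3<p kb<p)
      (coverable-∣ (*-monoˡ-∣ (p ^ 1) (*-monoˡ-∣ (3 ^ suc b) (proper-^ 0 prime[2] f∣2 f<2))) cov))
    where
    p≢3 : p ≢ 3
    p≢3 = >⇒≢ 3<p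
    p∤2 : ¬ p ∣ 2
    p∤2 = ∤-^ pp prime[2] (>⇒≢ (<⇒≤ 3<p)) 1

primitive-2^3*5^*p : ∀ {p} → Prime p → 5 < p → PrimitiveCoveringNumber (2 ^ 3 * 5 ^ ((p ∸ 1) / 4) * p)
primitive-2^3*5^*p {p} pp 5<p = go ((p ∸ 1) / 4) (floor-< 4 p (≤-trans (s≤s z≤n) 5<p)) (floor-≥ 4 p) 3b<p
  where
  3b<p : 3 * suc ((p ∸ 1) / 4) < p
  -- 10 is the least `n` that `floor-bound 3 1` admits; below it only `p = 7` is left, where 3 · 2 <
  -- 7.
  3b<p with p <? 10
  ... | yes p<10 = from-yes (allUpTo? (λ p → prime? p →-dec (5 <? p →-dec (3 * suc ((p ∸ 1) / 4) <? p))) 10) p<10 pp 5<p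
  ... | no p≮10  = floor-bound 3 1 10 ((p ∸ 1) / 4) (≮⇒≥ p≮10) (floor-< 4 p (≤-trans (s≤s z≤n) 5<p))
  go : ∀ b → 4 * b < p → p ≤ 4 * suc b → 3 * suc b < p → PrimitiveCoveringNumber (2 ^ 3 * 5 ^ b * p)
  go zero    _    p≤4 _    = contradiction (≤-trans 5<p p≤4) (from-no (6 ≤? 4))
  go (suc b) kb<p p≤  3b<p = primitive-*^* prime[5] pp (from-no (5 ∣? 8)) (p∤2^ 3) p≢5 (divisorCount-^ prime[2] 3)
    (nearCoverable-2^ 3) (¬coverable-^ prime[2] 3) b kb<p p≤
    (λ f∣ f< cov → ¬coverable-*^*^ prime[5] pp (from-no (5 ∣? 4)) (p∤2^ 2) p≢5 (divisorCount-^ prime[2] 2)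
      (¬coverable-^ prime[2] 2) (suc b) 1 (from-yes (3 <? 5)) 3b<p
      (coverable-∣ (*-monoˡ-∣ (p ^ 1) (*-monoˡ-∣ (5 ^ suc b) (proper-^ 2 prime[2] f∣ f<))) cov))
    where
    p≢5 : p ≢ 5
    p≢5 = >⇒≢ 5<p
    p∤2^ : ∀ a → ¬ p ∣ 2 ^ a
    p∤2^ = ∤-^ pp prime[2] (>⇒≢ (≤-trans (m≤m+n 3 3) 5<p))

primitive-2^5*7^*p : ∀ {p} → Prime p → 7 < p → p ≢ 13 → p ≢ 19 →
  PrimitiveCoveringNumber (2 ^ 5 * 7 ^ ((p ∸ 1) / 6) * p)
primitive-2^5*7^*p {p} pp 7<p p≢13 p≢19 =
  go ((p ∸ 1) / 6) (floor-< 6 p (≤-trans (s≤s z≤n) 7<p)) (floor-≥ 6 p) 5b<p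
  where
  5b<p : 5 * suc ((p ∸ 1) / 6) < p
  -- 26 is the least `n` that `floor-bound 5 1` admits. Of the primes between 7 and 26, the cases
  -- 11, 17, 23 pass, while 13 and 19 give 15 and 20 on the left.
  5b<p with p <? 26
  ... | yes p<26 = from-yes (allUpTo? (λ p → prime? p →-dec (7 <? p →-dec (¬? (p ≟ 13) →-dec (¬? (p ≟ 19) →-dec
                     (5 * suc ((p ∸ 1) / 6) <? p))))) 26) p<26 pp 7<p p≢13 p≢19
  ... | no p≮26  = floor-bound 5 1 26 ((p ∸ 1) / 6) (≮⇒≥ p≮26) (floor-< 6 p (≤-trans (s≤s z≤n) 7<p))
  go : ∀ b → 6 * b < p → p ≤ 6 * suc b → 5 * suc b < p → PrimitiveCoveringNumber (2 ^ 5 * 7 ^ b * p)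
  go zero    _    p≤6 _    = contradiction (≤-trans 7<p p≤6) (from-no (8 ≤? 6))
  go (suc b) kb<p p≤  5b<p = primitive-*^* prime[7] pp (from-no (7 ∣? 32)) (p∤2^ 5) p≢7 (divisorCount-^ prime[2] 5)
    (nearCoverable-2^ 5) (¬coverable-^ prime[2] 5) b kb<p p≤
    (λ f∣ f< cov → ¬coverable-*^*^ prime[7] pp (from-no (7 ∣? 16)) (p∤2^ 4) p≢7 (divisorCount-^ prime[2] 4)
      (¬coverable-^ prime[2] 4) (suc b) 1 (from-yes (5 <? 7)) 5b<p
      (coverable-∣ (*-monoˡ-∣ (p ^ 1) (*-monoˡ-∣ (7 ^ suc b) (proper-^ 4 prime[2] f∣ f<))) cov))
    where
    p≢7 : p ≢ 7
    p≢7 = >⇒≢ 7<p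
    p∤2^ : ∀ a → ¬ p ∣ 2 ^ a
    p∤2^ = ∤-^ pp prime[2] (>⇒≢ (≤-trans (m≤m+n 3 5) 7<p))

divisorCount-2*3^ : ∀ a → DivisorCount (2 * 3 ^ a) (2 * suc a)
divisorCount-2*3^ = divisorCount-*^ prime[3] (from-no (3 ∣? 2)) (divisorCount-^ prime[2] 1)

nearCoverable-2*3^ : ∀ a → NearCoverable (2 * 3 ^ a)
nearCoverable-2*3^ =
  nearCoverable-*^ prime[3] (from-no (3 ∣? 2)) (divisorCount-^ prime[2] 1) ≤-refl (nearCoverable-2^ 1)

¬coverable-2*3^ : ∀ a → ¬ Coverable (2 * 3 ^ a)
¬coverable-2*3^ =
  ¬coverable-*^ prime[3] (from-no (3 ∣? 2)) (divisorCount-^ prime[2] 1) ≤-refl (¬coverable-^ prime[2] 1)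

primitive-2*3*5^*p : ∀ {p} → Prime p → 5 < p → PrimitiveCoveringNumber (2 * 3 * 5 ^ ((p ∸ 1) / 4) * p)
primitive-2*3*5^*p {p} pp 5<p = go ((p ∸ 1) / 4) (floor-< 4 p (≤-trans (s≤s z≤n) 5<p)) (floor-≥ 4 p)
  where
  p≢5 : p ≢ 5
  p≢5 = >⇒≢ 5<p
  p∤2^ : ∀ a → ¬ p ∣ 2 ^ a
  p∤2^ = ∤-^ pp prime[2] (>⇒≢ (≤-trans (m≤m+n 3 3) 5<p))
  p≢3 : p ≢ 3
  p≢3 = >⇒≢ (≤-trans (m≤m+n 4 2) 5<p)
  -- Coverability passes to multiples, so only the maximal proper divisors 2 and 3 matter; each has
  -- two divisors.
  split : ∀ {f} → f < 6 → f ∣ 6 → f ∣ 2 ⊎ f ∣ 3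
  split = from-yes (allUpTo? (λ f → f ∣? 6 →-dec (f ∣? 2 ⊎-dec f ∣? 3)) 6)
  go : ∀ b → 4 * b < p → p ≤ 4 * suc b → PrimitiveCoveringNumber (2 * 3 * 5 ^ b * p)
  go zero    _    p≤4 = contradiction (≤-trans 5<p p≤4) (from-no (6 ≤? 4))
  go (suc b) kb<p p≤  = primitive-*^* prime[5] pp (from-no (5 ∣? 6)) (∤-*^ pp prime[3] p≢3 (p∤2^ 1) 1) p≢5
    (divisorCount-2*3^ 1) (nearCoverable-2*3^ 1) (¬coverable-2*3^ 1) b kb<p p≤ ¬f
    where
    2b<p : 2 * suc (suc b) < p
    2b<p = floor-bound 2 2 6 (suc b) 5<p kb<p
    ¬f : ∀ {f} → f ∣ 6 → f < 6 → ¬ Coverable (f * 5 ^ suc b * p ^ 1)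
    ¬f f∣ f< cov with split f< f∣
    ... | inj₁ f∣2 = ¬coverable-*^*^ prime[5] pp (from-no (5 ∣? 2)) (p∤2^ 1) p≢5 (divisorCount-^ prime[2] 1)
                       (¬coverable-^ prime[2] 1) (suc b) 1 (from-yes (2 <? 5)) 2b<p
                       (coverable-∣ (*-monoˡ-∣ (p ^ 1) (*-monoˡ-∣ (5 ^ suc b) f∣2)) cov)
    ... | inj₂ f∣3 = ¬coverable-*^*^ prime[5] pp (from-no (5 ∣? 3)) (∤-^ pp prime[3] p≢3 1) p≢5 (divisorCount-^ prime[3] 1)
                       (¬coverable-^ prime[3] 1) (suc b) 1 (from-yes (2 <? 5)) 2b<p
                       (coverable-∣ (*-monoˡ-∣ (p ^ 1) (*-monoˡ-∣ (5 ^ suc b) f∣3)) cov)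

primitive-2*3^2*7^*p : ∀ {p} → Prime p → 7 < p → PrimitiveCoveringNumber (2 * 3 ^ 2 * 7 ^ ((p ∸ 1) / 6) * p)
primitive-2*3^2*7^*p {p} pp 7<p = go ((p ∸ 1) / 6) (floor-< 6 p (≤-trans (s≤s z≤n) 7<p)) (floor-≥ 6 p)
  where
  p≢7 : p ≢ 7
  p≢7 = >⇒≢ 7<p
  p∤2 : ¬ p ∣ 2
  p∤2 = ∤-^ pp prime[2] (>⇒≢ (≤-trans (m≤m+n 3 5) 7<p)) 1
  p≢3 : p ≢ 3
  p≢3 = >⇒≢ (≤-trans (m≤m+n 4 4) 7<p)
  -- 11 is the next prime after 7 and the least `n` that `floor-bound 4 2` admits.
  11≤p : 11 ≤ p
  11≤p = ≮⇒≥ λ p<11 → from-yes (allUpTo? (λ p → prime? p →-dec ¬? (7 <? p)) 11) p<11 pp 7<p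
  -- The maximal proper divisors 6 and 9 have 4 and 3 divisors, against 6 for 18.
  split : ∀ {f} → f < 18 → f ∣ 18 → f ∣ 6 ⊎ f ∣ 9
  split = from-yes (allUpTo? (λ f → f ∣? 18 →-dec (f ∣? 6 ⊎-dec f ∣? 9)) 18)
  go : ∀ b → 6 * b < p → p ≤ 6 * suc b → PrimitiveCoveringNumber (2 * 3 ^ 2 * 7 ^ b * p)
  go zero    _    p≤6 = contradiction (≤-trans 7<p p≤6) (from-no (8 ≤? 6))
  go (suc b) kb<p p≤  = primitive-*^* prime[7] pp (from-no (7 ∣? 18)) (∤-*^ pp prime[3] p≢3 p∤2 2) p≢7
    (divisorCount-2*3^ 2) (nearCoverable-2*3^ 2) (¬coverable-2*3^ 2) b kb<p p≤ ¬f
    where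
    ¬f : ∀ {f} → f ∣ 18 → f < 18 → ¬ Coverable (f * 7 ^ suc b * p ^ 1)
    ¬f f∣ f< cov with split f< f∣
    ... | inj₁ f∣6 = ¬coverable-*^*^ prime[7] pp (from-no (7 ∣? 6)) (∤-*^ pp prime[3] p≢3 p∤2 1) p≢7 (divisorCount-2*3^ 1)
                       (¬coverable-2*3^ 1) (suc b) 1 (from-yes (4 <? 7)) (floor-bound 4 2 11 (suc b) 11≤p kb<p)
                       (coverable-∣ (*-monoˡ-∣ (p ^ 1) (*-monoˡ-∣ (7 ^ suc b) f∣6)) cov)
    ... | inj₂ f∣9 = ¬coverable-*^*^ prime[7] pp (from-no (7 ∣? 9)) (∤-^ pp prime[3] p≢3 2) p≢7 (divisorCount-^ prime[3] 2)
                       (¬coverable-^ prime[3] 2) (suc b) 1 (from-yes (3 <? 7)) (floor-bound 3 3 11 (suc b) 11≤p kb<p)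
                       (coverable-∣ (*-monoˡ-∣ (p ^ 1) (*-monoˡ-∣ (7 ^ suc b) f∣9)) cov)

-- Numbers with at most three prime divisors

-- Replaces the number ω(n) by a list in any order, from whose head a full prime power can be split
-- off.
record PrimeSupport (n : ℕ) (ps : List ℕ) : Set where
  field
    positive : 0 < n
    primes   : All (λ p → Prime p × p ∣ n) ps
    unique   : Unique ps
    complete : ∀ {p} → Prime p → p ∣ n → p ∈ ps

primeSupport-↭ : ∀ {n ps qs} → ps ↭ qs → PrimeSupport n ps → PrimeSupport n qs
primeSupport-↭ ps↭qs S = record
  { positive = PrimeSupport.positive S
  ; primes   = All-resp-↭ ps↭qs (PrimeSupport.primes S)
  ; unique   = Unique-resp-↭ (↭⇒↭ₛ ps↭qs) (PrimeSupport.unique S)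
  ; complete = λ pr p∣n → ∈-resp-↭ ps↭qs (PrimeSupport.complete S pr p∣n)
  }

primeSupport : ∀ {n} → 0 < n → PrimeSupport n (primeDivisors n)
primeSupport {n} 0<n = record
  { positive = 0<n
  ; primes   = All-filter P? (upTo (suc n))
  ; unique   = Unique.filter⁺ P? (Unique.upTo⁺ (suc n))
  ; complete = λ pr p∣n → ∈-filter⁺ P? (∈-upTo⁺ (s≤s (∣⇒≤ {{>-nonZero 0<n}} p∣n))) (pr , p∣n)
  }
  where
  P? : ∀ p → Dec (Prime p × p ∣ n)
  P? p = prime? p ×-dec (p ∣? n)

primeSupport-[] : ∀ {n} → PrimeSupport n [] → n ≡ 1
primeSupport-[] {n} S with factorise n {{>-nonZero (PrimeSupport.positive S)}}
... | record { factors = [] ; isFactorisation = n≡1 } = n≡1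
... | record { factors = p ∷ ps ; isFactorisation = n≡ ; factorsPrime = pr ∷ _ }
  with () ← PrimeSupport.complete S pr (subst (p ∣_) (sym n≡) (m∣m*n (product ps)))

strip : ∀ {p} → Prime p → ∀ n → 0 < n → p ∣ n → ∃₂ λ m a → n ≡ m * p ^ suc a × ¬ p ∣ m × 0 < m
strip {p} pr = <-rec _ step
  where
  m<m*p : ∀ {m} → 0 < m → m < m * p
  m<m*p {m} 0<m = m<m*n m p {{>-nonZero 0<m}} (nonTrivial⇒n>1 p {{prime⇒nonTrivial pr}})
  lemma : ∀ k p x → k * (p * x) * p ≡ k * (p * (p * x))
  lemma = solve-∀
  step : ∀ n → (∀ {m} → m < n → 0 < m → p ∣ m → ∃₂ λ k a → m ≡ k * p ^ suc a × ¬ p ∣ k × 0 < k) →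
    0 < n → p ∣ n → ∃₂ λ m a → n ≡ m * p ^ suc a × ¬ p ∣ m × 0 < m
  step n rec 0<n (divides m n≡) with 0<m ← ∣⇒0< 0<n (divides p (trans n≡ (*-comm m p))) with p ∣? m
  ... | no p∤m = m , 0 , trans n≡ (cong (m *_) (sym (*-identityʳ p))) , p∤m , 0<m
  ... | yes p∣m with k , a , m≡ , p∤k , 0<k ← rec (subst (m <_) (sym n≡) (m<m*p 0<m)) 0<m p∣m =
    k , suc a , trans n≡ (trans (cong (_* p) m≡) (lemma k p (p ^ a))) , p∤k , 0<k

primeSupport-∷ : ∀ {n p ps} → PrimeSupport n (p ∷ ps) →
  ∃₂ λ m a → n ≡ m * p ^ suc a × ¬ p ∣ m × PrimeSupport m ps
primeSupport-∷ {n} {p} {ps} record { positive = 0<n ; primes = (pr , p∣n) ∷ rest ; unique = p∉ ∷ u ; complete = comp }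
  with m , a , refl , p∤m , 0<m ← strip pr n 0<n p∣n = m , a , refl , p∤m , record
  { positive = 0<m
  ; primes   = All.tabulate λ q∈ → let pq , q∣n = All.lookup rest q∈ in pq ,
                 [ id , (λ q∣ → contradiction q∣ (∤-^ pq pr (≢-sym (All.lookup p∉ q∈)) (suc a))) ]′
                   (euclidsLemma m (p ^ suc a) pq q∣n)
  ; unique   = u
  ; complete = λ {q} pq q∣m → tail q∣m (comp pq (∣m⇒∣m*n (p ^ suc a) q∣m))
  }
  where
  tail : ∀ {q} → q ∣ m → q ∈ p ∷ ps → q ∈ ps
  tail q∣m (here refl) = contradiction q∣m p∤m
  tail q∣m (there q∈)  = q∈

primeSupport₁ : ∀ {n p} → PrimeSupport n (p ∷ []) → ∃[ a ] n ≡ p ^ suc a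
primeSupport₁ {p = p} S with m , a , refl , _ , S₁ ← primeSupport-∷ S =
  a , trans (cong (_* p ^ suc a) (primeSupport-[] S₁)) (*-identityˡ _)

primeSupport₂ : ∀ {n p q} → PrimeSupport n (q ∷ p ∷ []) → ∃₂ λ a b → n ≡ p ^ suc a * q ^ suc b
primeSupport₂ {q = q} S with m , b , refl , _ , S₁ ← primeSupport-∷ S with a , refl ← primeSupport₁ S₁ = a , b , refl

primeSupport₃ : ∀ {n p q r} → PrimeSupport n (r ∷ q ∷ p ∷ []) →
  ∃[ a ] ∃[ b ] ∃[ c ] n ≡ p ^ suc a * q ^ suc b * r ^ suc c
primeSupport₃ S with m , c , refl , _ , S₁ ← primeSupport-∷ S with a , b , refl ← primeSupport₂ S₁ = a , b , c , refl

-- This is how the forward directions identify `n`: once a known covering number divides `n`,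
-- minimality forces equality.
primitive-∣ : ∀ {d n} → 0 < n → PrimitiveCoveringNumber n → d ∣ n → CoveringNumber d → n ≡ d
primitive-∣ {d} {n} 0<n (_ , min) d∣n D with d ≟ n
... | yes d≡n = sym d≡n
... | no d≢n  = contradiction D (min d d∣n (≤∧≢⇒< (∣⇒≤ {{>-nonZero 0<n}} d∣n) d≢n))

-- If τ(m) < p, reduction would make the proper divisor `m p^a` a covering number.
primitive-τ : ∀ {p m t a} → Prime p → ¬ p ∣ m → DivisorCount m t → PrimitiveCoveringNumber (m * p ^ suc a) → p ≤ t
primitive-τ {p} {m} {t} {a} pr p∤m D (cov , min) = ≮⇒≥ λ t<p → min (m * p ^ a) (*-monoʳ-∣ m (n∣m*n p))
  (*-monoʳ-< m {{>-nonZero (positive D)}} (subst (p ^ a <_) (*-comm (p ^ a) p)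
    (m<m*n (p ^ a) p {{m^n≢0 p a {{prime⇒nonZero pr}}}} (nonTrivial⇒n>1 p {{prime⇒nonTrivial pr}}))))
  (coverable⇒covering (positive (divisorCount-*^ pr p∤m D a))
    (coverable-reduce pr p∤m D t<p a (covering⇒coverable cov)))

^-∣ : ∀ {m n} p → m ≤ n → p ^ m ∣ p ^ n
^-∣ {m} {n} p m≤n = subst (p ^ m ∣_)
  (trans (sym (^-distribˡ-+-* p m (n ∸ m))) (cong (p ^_) (m+[n∸m]≡n m≤n))) (m∣m*n (p ^ (n ∸ m)))

prime-≥3 : ∀ {p} → Prime p → p ≢ 2 → 3 ≤ p
prime-≥3 {p} pr p≢2 = ≤∧≢⇒< (nonTrivial⇒n>1 p {{prime⇒nonTrivial pr}}) (≢-sym p≢2)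

prime-≥5 : ∀ {p} → Prime p → p ≢ 2 → p ≢ 3 → 5 ≤ p
prime-≥5 pr p≢2 p≢3 = ≤∧≢⇒< (≤∧≢⇒< (prime-≥3 pr p≢2) (≢-sym p≢3)) λ { refl → from-no (prime? 4) pr }

prime-≥7 : ∀ {p} → Prime p → p ≢ 2 → p ≢ 3 → p ≢ 5 → 7 ≤ p
prime-≥7 pr p≢2 p≢3 p≢5 = ≤∧≢⇒< (≤∧≢⇒< (prime-≥5 pr p≢2 p≢3) (≢-sym p≢5)) λ { refl → from-no (prime? 6) pr }

-- `primitive-τ` gives `q ≤ τ(2^a) = a + 1`, so the covering number `2^(q-1) q` divides `n`.
primitive-2^*^⇒ : ∀ {q a b} → Prime q → q ≢ 2 → PrimitiveCoveringNumber (2 ^ a * q ^ suc b) →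
  2 ^ a * q ^ suc b ≡ 2 ^ (q ∸ 1) * q
primitive-2^*^⇒ {q} {a} {b} pq q≢2 prim = primitive-∣ (proj₁ (proj₁ prim)) prim
  (*-pres-∣ (^-∣ 2 (∸-monoˡ-≤ 1 q≤)) (m∣m*n (q ^ b)))
  (proj₁ (primitive-2^*p pq q≢2))
  where
  q≤ : q ≤ suc a
  q≤ = primitive-τ {a = b} pq (∤-^ pq prime[2] q≢2 a) (divisorCount-^ prime[2] a) prim

¬2∣prime : ∀ {p} → Prime p → p ≢ 2 → ¬ 2 ∣ p
¬2∣prime pr p≢2 = p≢2 ∘ sym ∘ prime∣prime⇒≡ prime[2] pr

swap₂ : ∀ {x y : ℕ} → x ∷ y ∷ [] ↭ y ∷ x ∷ []
swap₂ {x} {y} = ↭.swap x y ↭.refl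

primitive₂⇒ : ∀ {n ps} → 1 < n → length ps ≤ 2 → PrimeSupport n ps → PrimitiveCoveringNumber n →
  ∃[ p ] (Prime p × ¬ (2 ∣ p) × n ≡ 2 ^ (p ∸ 1) * p)
primitive₂⇒ {ps = []} 1<n _ S prim = contradiction (primeSupport-[] S) (>⇒≢ 1<n)
primitive₂⇒ {ps = p ∷ []} _ _ S prim with a , refl ← primeSupport₁ S with (pp , _) ∷ _ ← PrimeSupport.primes S =
  contradiction (covering⇒coverable (proj₁ prim)) (¬coverable-^ pp (suc a))
primitive₂⇒ {ps = _ ∷ _ ∷ _ ∷ _} _ (s≤s (s≤s ())) _ _
primitive₂⇒ {n} {p ∷ q ∷ []} _ _ S prim
  with (pp , _) ∷ (pq , _) ∷ [] ← PrimeSupport.primes S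
  with (p≢q ∷ []) ∷ _ ← PrimeSupport.unique S
  with p ≟ 2 | q ≟ 2
... | yes refl | yes refl = contradiction refl p≢q
... | no p≢2 | yes refl with a , b , refl ← primeSupport₂ S =
  p , pp , ¬2∣prime pp p≢2 , primitive-2^*^⇒ {a = suc a} {b} pp p≢2 prim
... | yes refl | no q≢2 with a , b , refl ← primeSupport₂ (primeSupport-↭ swap₂ S) =
  q , pq , ¬2∣prime pq q≢2 , primitive-2^*^⇒ {a = suc a} {b} pq q≢2 prim
-- Of two distinct odd primes one is at least 5; it supplies the bound 5/4, and the other is the
-- separated prime.
... | no p≢2 | no q≢2 with p ≟ 3
...   | yes refl with a , b , refl ← primeSupport₂ S = contradiction (covering⇒coverable (proj₁ prim))
          (¬coverable-odd₂ pp pq ≤-refl (prime-≥5 pq q≢2 (≢-sym p≢q)) p≢q (suc b) (suc a))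
...   | no p≢3 with a , b , refl ← primeSupport₂ (primeSupport-↭ swap₂ S) = contradiction (covering⇒coverable (proj₁ prim))
          (¬coverable-odd₂ pq pp (prime-≥3 pq q≢2) (prime-≥5 pp p≢2 p≢3) (≢-sym p≢q) (suc b) (suc a))

-- If 4 divided `n`, then `n` would be 12, which has no prime divisor `p` besides 2 and 3. With a
-- single factor 2, `primitive-τ` gives `p ≤ τ(2 · 3^(b+1)) = 2 (b + 2)`, which makes the power of 3
-- large enough.
primitive-2^*3^*^⇒ : ∀ {p a b c} → Prime p → p ≢ 2 → p ≢ 3 →
  PrimitiveCoveringNumber (2 ^ suc a * 3 ^ suc b * p ^ suc c) →
  2 ^ suc a * 3 ^ suc b * p ^ suc c ≡ 2 * 3 ^ ((p ∸ 1) / 2) * p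
primitive-2^*3^*^⇒ {p} {suc a} {b} {c} pp p≢2 p≢3 prim = ⊥-elim
  (∤-* pp (∤-^ pp prime[2] p≢2 2) (∤-^ pp prime[3] p≢3 1)
    (subst (p ∣_) n≡12 (∣n⇒∣m*n (2 ^ suc (suc a) * 3 ^ suc b) (m∣m*n (p ^ c)))))
  where
  -- 12 = 2^2 * 3 is a covering number.
  n≡12 : 2 ^ suc (suc a) * 3 ^ suc b * p ^ suc c ≡ 12
  n≡12 = primitive-∣ (proj₁ (proj₁ prim)) prim
    (∣m⇒∣m*n (p ^ suc c) (*-pres-∣ {o = 4} {p = 3} (^-∣ 2 (s≤s (s≤s (z≤n {a})))) (m∣m*n (3 ^ b))))
    (proj₁ (primitive-2^*p prime[3] λ ()))
primitive-2^*3^*^⇒ {p} {zero} {b} {c} pp p≢2 p≢3 prim = primitive-∣ (proj₁ (proj₁ prim)) prim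
  (*-pres-∣ (*-monoʳ-∣ 2 (^-∣ 3 (s≤s⁻¹ half<))) (m∣m*n (p ^ c)))
  (proj₁ (primitive-2*3^*p pp (<⇒≤ (prime-≥5 pp p≢2 p≢3))))
  where
  p≤ : p ≤ 2 * suc (suc b)
  p≤ = primitive-τ {a = c} pp (∤-*^ pp prime[3] p≢3 (∤-^ pp prime[2] p≢2 1) (suc b)) (divisorCount-2*3^ (suc b)) prim
  half< : (p ∸ 1) / 2 < suc (suc b)
  half< = m<n*o⇒m/o<n (subst (p ∸ 1 <_) (*-comm 2 (suc (suc b)))
    (≤-trans (≤-reflexive (m+[n∸m]≡n (<⇒≤ (nonTrivial⇒n>1 p {{prime⇒nonTrivial pp}})))) p≤))

primitive₃⇒ : ∀ {n q r} → PrimeSupport n (3 ∷ q ∷ r ∷ []) → PrimitiveCoveringNumber n →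
  ∃[ p ] (Prime p × 3 < p × n ≡ 2 * 3 ^ ((p ∸ 1) / 2) * p)
primitive₃⇒ {n} {q} {r} S prim
  with _ ∷ (pq , _) ∷ (pr , _) ∷ [] ← PrimeSupport.primes S
  with (3≢q ∷ 3≢r ∷ []) ∷ (q≢r ∷ []) ∷ _ ← PrimeSupport.unique S
  with q ≟ 2 | r ≟ 2
... | yes refl | yes refl = contradiction refl q≢r
... | yes refl | no r≢2 with a , b , c , refl ← primeSupport₃ (primeSupport-↭
          (↭.trans (↭.prep 3 swap₂) (↭.swap 3 r ↭.refl)) S) =
  r , pr , <⇒≤ (prime-≥5 pr r≢2 (≢-sym 3≢r)) , primitive-2^*3^*^⇒ {a = a} {b} {c} pr r≢2 (≢-sym 3≢r) prim
... | no q≢2 | yes refl with a , b , c , refl ← primeSupport₃ (primeSupport-↭ (↭.swap 3 q ↭.refl) S) =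
  q , pq , <⇒≤ (prime-≥5 pq q≢2 (≢-sym 3≢q)) , primitive-2^*3^*^⇒ {a = a} {b} {c} pq q≢2 (≢-sym 3≢q) prim
-- With 3 as the separated prime, the other two are at least 5 and 7 in some order.
... | no q≢2 | no r≢2 with q ≟ 5
...   | yes refl with a , b , c , refl ← primeSupport₃ (primeSupport-↭ (↭.prep 3 swap₂) S) =
  contradiction (covering⇒coverable (proj₁ prim))
    (¬coverable-odd₃ prime[3] pq pr ≤-refl ≤-refl (prime-≥7 pr r≢2 (≢-sym 3≢r) (≢-sym q≢r)) 3≢q 3≢r (≢-sym q≢r)
      (suc c) (suc a) (suc b))
...   | no q≢5 with a , b , c , refl ← primeSupport₃ S =
  contradiction (covering⇒coverable (proj₁ prim))
    (¬coverable-odd₃ prime[3] pr pq ≤-refl (prime-≥5 pr r≢2 (≢-sym 3≢r)) (prime-≥7 pq q≢2 (≢-sym 3≢q) q≢5) 3≢r 3≢q q≢r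
      (suc c) (suc a) (suc b))

to-front : ∀ {x : ℕ} {xs} → x ∈ xs → length xs ≡ 3 → ∃₂ λ y z → xs ↭ x ∷ y ∷ z ∷ []
to-front {xs = x ∷ y ∷ z ∷ []} (here refl) _                 = y , z , ↭.refl
to-front {xs = y ∷ x ∷ z ∷ []} (there (here refl)) _         = y , z , ↭.swap y x ↭.refl
to-front {xs = y ∷ z ∷ x ∷ []} (there (there (here refl))) _ =
  y , z , ↭.trans (↭.prep y swap₂) (↭.swap y x ↭.refl)

theorem1p4 : (∀ (n : ℕ) → 1 < n → ω n ≤ 2 →
    PrimitiveCoveringNumber n ⇔
    (∃[ p ] (Prime p × ¬ (2 ∣ p) × n ≡ 2 ^ (p ∸ 1) * p)))
    ×
    (∀ (n : ℕ) → 0 < n → 3 ∣ n → ω n ≡ 3 →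
    PrimitiveCoveringNumber n ⇔
    (∃[ p ] (Prime p × 3 < p × n ≡ 2 * 3 ^ ((p ∸ 1) / 2) * p)))
    ×
    ((∀ (p : ℕ) → Prime p → 5 < p →
    PrimitiveCoveringNumber (2 ^ 3 * 5 ^ ((p ∸ 1) / 4) * p) ×
    PrimitiveCoveringNumber (2 * 3 * 5 ^ ((p ∸ 1) / 4) * p))
    ×
    (∀ (p : ℕ) → Prime p → 7 < p →
    PrimitiveCoveringNumber (2 * 3 ^ 2 * 7 ^ ((p ∸ 1) / 6) * p) ×
    (p ≢ 13 → p ≢ 19 →
    PrimitiveCoveringNumber (2 ^ 5 * 7 ^ ((p ∸ 1) / 6) * p))))
theorem1p4 =
  (λ n 1<n ω≤2 → mk⇔
    (primitive₂⇒ 1<n ω≤2 (primeSupport (<⇒≤ 1<n)))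
    (λ { (p , pp , 2∤p , refl) → primitive-2^*p pp (λ { refl → 2∤p ∣-refl }) })) ,
  (λ n 0<n 3∣n ω≡3 → mk⇔
    (λ prim → let S = primeSupport 0<n
                  _ , _ , perm = to-front (PrimeSupport.complete S prime[3] 3∣n) ω≡3
              in primitive₃⇒ (primeSupport-↭ perm S) prim)
    (λ { (p , pp , 3<p , refl) → primitive-2*3^*p pp 3<p })) ,
  (λ p pp 5<p → primitive-2^3*5^*p pp 5<p , primitive-2*3*5^*p pp 5<p) ,
  (λ p pp 7<p → primitive-2*3^2*7^*p pp 7<p , primitive-2^5*7^*p pp 7<p)
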